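{- Let $\mathfrak{c}$ be a subset of $\mathfrak{u}(T_n)$ with $|\mathfrak{c}| \ge 4$. Then $\mathfrak{c}$ is a circuit of the tiling matroid $\mathcal{T}_n$ if and only if both of the following hold: (1) the triangular hull of $\mathfrak{c}$ is the only lattice upward triangle of $T_n$ strictly over-saturated by $\mathfrak{c}$; (2) the minimum number of type-2 trapezoids used in a tiling of $T_n \setminus A(\mathfrak{c})$ into unit rhombi and unit trapezoids (type-1 and type-2 trapezoids) is $1$.
   Context: $T_n$ is a closed equilateral triangle of side length $n$ with horizontal base and apex up, subdivided by lines parallel to its sides at integer distances into unit equilateral triangles; upward-pointing ones are unit upward triangles (set $\mathfrak{u}(T_n)$), downward-pointing ones unit downward triangles. A lattice upward triangle of size $k$ is a translate of $T_k$ contained in $T_n$ that is a union of unit triangles; $\mathfrak{u}(T)$ is the set of unit upward triangles inside $T$. The tiling matroid $\mathcal{T}_n$ has ground set $\mathfrak{u}(T_n)$ and independent sets the $\mathfrak{s}$ with $|\mathfrak{s}\cap\mathfrak{u}(T)|\le k$ for every lattice upward triangle $T$ of size $k$; a circuit is a minimal dependent set. $T$ of size $k$ is strictly over-saturated by $\mathfrak{s}$ if $|\mathfrak{s}\cap\mathfrak{u}(T)|>k$. The triangular hull of $\mathfrak{c}$ is the smallest lattice upward triangle containing all triangles of $\mathfrak{c}$. $A(\mathfrak{c})$ is the union of the triangles in $\mathfrak{c}$. A tiling of a lattice region (nonempty subset of $T_n$ whose closure is a union of unit triangles) is a collection of closed lattice regions with pairwise disjoint interiors whose union is the closure of the region.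 A unit rhombus is the union of two unit triangles sharing an edge. A type-1 trapezoid is a lattice trapezoid that is the union of two unit upward triangles and one unit downward triangle; a type-2 trapezoid is a lattice trapezoid that is the union of one unit upward triangle and two unit downward triangles. -}

module Defs where

open import Data.Nat using (ℕ; zero; suc; _+_; _∸_; _≤_; _<_; _≡ᵇ_)
open import Data.Bool using (Bool; true; false; if_then_else_; _∧_)
open import Data.List using (List; []; _∷_; map)
open import Data.Nat.ListAction using (sum)
open import Data.List.Relation.Unary.All using (All)
open import Data.Product using (_×_; Σ; ∃; ∃-syntax)
open import Relation.Binary.PropositionalEquality using (_≡_)
open import Relation.Nullary using (¬_)

-- Coordinates.  Lattice basis e1 = (1,0), e2 = (1/2, √3/2); T_n has vertices
-- 0, n e1, n e2.  The unit upward triangle  up i j  has vertices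
-- (i,j),(i+1,j),(i,j+1)  and lies in T_n iff i + j < n.
-- The unit downward triangle  down i j  has vertices (i+1,j),(i,j+1),(i+1,j+1)
-- and lies in T_n iff i + j + 2 ≤ n.

data UT : Set where
  up   : ℕ → ℕ → UT
  down : ℕ → ℕ → UT

eqUT : UT → UT → Bool
eqUT (up i j)   (up k l)   = (i ≡ᵇ k) ∧ (j ≡ᵇ l)
eqUT (down i j) (down k l) = (i ≡ᵇ k) ∧ (j ≡ᵇ l)
eqUT _ _ = false

-- A subset of u(T_n) is a Boolean predicate on coordinates (i,j) of unit
-- upward triangles, required (in the theorem) to vanish outside T_n.
USet : Set
USet = ℕ → ℕ → Bool

_⊆ᵤ_ : USet → USet → Set
s ⊆ᵤ t = ∀ i j → s i j ≡ true → t i j ≡ true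

InTn : ℕ → USet → Set
InTn n s = ∀ i j → s i j ≡ true → i + j < n

sumBelow : ℕ → (ℕ → ℕ) → ℕ
sumBelow zero    f = 0
sumBelow (suc k) f = sumBelow k f + f k

ind : Bool → ℕ
ind true  = 1
ind false = 0

-- Lattice upward triangle with lower-left corner (a,b) and size k:
-- it is the translate of T_k by a e1 + b e2; it lies in T_n iff a + b + k ≤ n.
-- Its unit upward triangles are  up (a+i) (b+j)  with i + j < k.
LatTri : ℕ → ℕ → ℕ → ℕ → Set
LatTri n a b k = (1 ≤ k) × (a + b + k ≤ n)

cnt : USet → ℕ → ℕ → ℕ → ℕ
cnt s a b k = sumBelow k (λ i → sumBelow (k ∸ i) (λ j → ind (s (a + i) (b + j))))

card : ℕ → USet → ℕ
card n s = cnt s 0 0 n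

Independent : ℕ → USet → Set
Independent n s = ∀ a b k → LatTri n a b k → cnt s a b k ≤ k

Dependent : ℕ → USet → Set
Dependent n s = ¬ Independent n s

_⊂ᵤ_ : USet → USet → Set
s ⊂ᵤ c = (s ⊆ᵤ c) × (∃[ i ] ∃[ j ] (c i j ≡ true × s i j ≡ false))

Circuit : ℕ → USet → Set
Circuit n c = Dependent n c × (∀ s → s ⊂ᵤ c → Independent n s)

OverSat : USet → ℕ → ℕ → ℕ → Set
OverSat s a b k = k < cnt s a b k

Contains : USet → ℕ → ℕ → ℕ → Set
Contains c a b k = ∀ i j → c i j ≡ true → (a ≤ i) × (b ≤ j) × (i + j < a + b + k)

IsHull : ℕ → USet → ℕ → ℕ → ℕ → Set
IsHull n c a b k =
  LatTri n a b k × Contains c a b k ×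
  (∀ a' b' k' → LatTri n a' b' k' → Contains c a' b' k' → k ≤ k')

InRegion : ℕ → USet → UT → Set
InRegion n c (up i j)   = (i + j < n) × (c i j ≡ false)
InRegion n c (down i j) = suc (suc (i + j)) ≤ n

-- Tiles: unit rhombi, type-1 trapezoids (2 up + 1 down),
-- type-2 trapezoids (1 up + 2 down), given by their unit triangles.
-- The down triangle  down i j  is adjacent exactly to up i j, up (i+1) j,
-- up i (j+1); the up triangle  up i j  is adjacent exactly to down i j,
-- down (i-1) j, down i (j-1).
data Tile : Set where
  rhombA rhombB rhombC : ℕ → ℕ → Tile
  trap1A trap1B trap1C : ℕ → ℕ → Tile
  trap2A trap2B trap2C : ℕ → ℕ → Tile

cells : Tile → List UT
cells (rhombA i j) = down i j ∷ up i j ∷ []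
cells (rhombB i j) = down i j ∷ up (suc i) j ∷ []
cells (rhombC i j) = down i j ∷ up i (suc j) ∷ []
cells (trap1A i j) = down i j ∷ up i j ∷ up (suc i) j ∷ []
cells (trap1B i j) = down i j ∷ up i j ∷ up i (suc j) ∷ []
cells (trap1C i j) = down i j ∷ up (suc i) j ∷ up i (suc j) ∷ []
cells (trap2A i j) = up (suc i) j ∷ down (suc i) j ∷ down i j ∷ []
cells (trap2B i j) = up i (suc j) ∷ down i (suc j) ∷ down i j ∷ []
cells (trap2C i j) = up (suc i) (suc j) ∷ down i (suc j) ∷ down (suc i) j ∷ []

isType2 : Tile → Bool
isType2 (trap2A _ _) = true
isType2 (trap2B _ _) = true
isType2 (trap2C _ _) = true
isType2 _            = false

occ : UT → List Tile → ℕ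
occ t ts = sum (map (λ τ → sum (map (λ u → ind (eqUT t u)) (cells τ))) ts)

Tiling : ℕ → USet → List Tile → Set
Tiling n c ts =
  All (λ τ → All (InRegion n c) (cells τ)) ts ×
  (∀ t → InRegion n c t → occ t ts ≡ 1)

numType2 : List Tile → ℕ
numType2 ts = sum (map (λ τ → ind (isType2 τ)) ts)

HullOnlyOverSat : ℕ → USet → Set
HullOnlyOverSat n c =
  ∀ a b k → LatTri n a b k →
    (OverSat c a b k → IsHull n c a b k) × (IsHull n c a b k → OverSat c a b k)

MinType2IsOne : ℕ → USet → Set
MinType2IsOne n c =
  (∃[ ts ] (Tiling n c ts × numType2 ts ≡ 1)) ×
  (∀ ts → Tiling n c ts → 1 ≤ numType2 ts)

{-# OPTIONS --safe #-}
module Submission where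

-- Counting.  The downward triangles of a triangle T of size k number k fewer than its
-- upward ones and have all their neighbours inside T, so every tiling uses at least
-- |c ∩ u(T)| − k tiles of type 2.  A circuit is over-saturated by exactly one, at its
-- hull; conversely a set over-saturated by one at its hull, and nowhere else, is a circuit.
--
-- Construction.  Remove one element x of a circuit c.  In an independent set, the hole
-- up p q can always be moved across down p q, to up (p+1) q or to up p (q+1), keeping
-- independence: otherwise two saturated triangles would have a saturated join containing
-- up p q.  Sweeping the hull row by row, a rhombus is laid for each downward triangle, on
-- the neighbour to which the hole moves or on up p q if that is no hole; this tiles the
-- hull minus c ∖ {x} by rhombi.  Making x a hole again frees one downward triangle, which
-- joins the rhombus of a neighbouring upward triangle outside c into a type-2 trapezoid;
-- such a neighbour exists because |c| ≥ 4.  Finally the hull is enlarged to T_n by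
-- strips, each tiled by rhombi and one type-1 trapezoid.

open import Defs
open import Data.Nat
open import Data.Nat.Properties
open import Data.Nat.ListAction using (sum)
open import Data.Nat.Tactic.RingSolver using (solve-∀)
open import Data.Bool using (Bool; true; false; _∧_; _∨_; not)
open import Data.Bool.Properties using (T-≡; ∧-comm; ∧-zeroʳ; ∧-identityʳ; ∨-zeroʳ; ∨-identityʳ)
open import Data.List using (List; []; _∷_; map)
open import Data.List.Relation.Unary.All as All using (All; []; _∷_)
open import Data.List.Relation.Unary.AllPairs as AllPairs using ()
open import Data.List.Relation.Unary.Any using (here; there)
open import Data.List.Relation.Unary.Unique.Propositional using (Unique)
open import Data.List.Membership.Propositional using (_∈_; _∉_)
open import Data.Product using (_×_; _,_; proj₁; proj₂; ∃-syntax)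
open import Data.Sum using (_⊎_; inj₁; inj₂; [_,_]′)
open import Data.Empty using (⊥; ⊥-elim)
open import Relation.Binary.PropositionalEquality
open import Relation.Binary.Definitions using (DecidableEquality)
open import Relation.Nullary using (¬_; Dec; yes; no; does; contradiction)
open import Relation.Nullary.Decidable using (_×-dec_; map′; dec-true; dec-false)
open import Function using (_∘_; id; Equivalence)

-- Linear inequalities and finite sums.

-- A linear inequality s ≤ t follows from p ≤ q once the semiring solver
-- exhibits the slack e.
lin : ∀ {s t p q} e → p ≤ q → s + q + e ≡ t + p → s ≤ t
lin {s} {t} {p} {q} e p≤q eq =
  ≤-trans (m≤m+n s e) (+-cancelʳ-≤ q (s + e) t (begin
    s + e + q  ≡⟨ assoc-comm s e q ⟩
    s + q + e  ≡⟨ eq ⟩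
    t + p      ≤⟨ +-monoʳ-≤ t p≤q ⟩
    t + q      ∎))
  where
  open ≤-Reasoning
  assoc-comm : ∀ s e q → s + e + q ≡ s + q + e
  assoc-comm = solve-∀

absurd : ∀ {p q} e → p ≤ q → p ≡ suc (q + e) → ⊥
absurd {q = q} e p≤q refl = <⇒≱ (s≤s (m≤m+n q e)) p≤q

sum-cong : ∀ k {f g : ℕ → ℕ} → (∀ i → i < k → f i ≡ g i) → sumBelow k f ≡ sumBelow k g
sum-cong zero    h = refl
sum-cong (suc k) h = cong₂ _+_ (sum-cong k λ i i<k → h i (m<n⇒m<1+n i<k)) (h k ≤-refl)

sum-mono : ∀ k {f g : ℕ → ℕ} → (∀ i → i < k → f i ≤ g i) → sumBelow k f ≤ sumBelow k g
sum-mono zero    h = z≤n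
sum-mono (suc k) h = +-mono-≤ (sum-mono k λ i i<k → h i (m<n⇒m<1+n i<k)) (h k ≤-refl)

sum-+ : ∀ k (f g : ℕ → ℕ) → sumBelow k (λ i → f i + g i) ≡ sumBelow k f + sumBelow k g
sum-+ zero    f g = refl
sum-+ (suc k) f g rewrite sum-+ k f g = interchange (sumBelow k f) (sumBelow k g) (f k) (g k)
  where
  interchange : ∀ x y u v → x + y + (u + v) ≡ x + u + (y + v)
  interchange = solve-∀

sum-0 : ∀ k {f : ℕ → ℕ} → (∀ i → i < k → f i ≡ 0) → sumBelow k f ≡ 0
sum-0 zero    h = refl
sum-0 (suc k) h = cong₂ _+_ (sum-0 k λ i i<k → h i (m<n⇒m<1+n i<k)) (h k ≤-refl)

sum-front : ∀ k (f : ℕ → ℕ) → sumBelow (suc k) f ≡ f 0 + sumBelow k (f ∘ suc)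
sum-front zero    f = +-comm 0 (f 0)
sum-front (suc k) f = trans (cong (_+ f (suc k)) (sum-front k f)) (+-assoc (f 0) _ _)

sum-split : ∀ a k (f : ℕ → ℕ) → sumBelow (a + k) f ≡ sumBelow a f + sumBelow k (λ i → f (a + i))
sum-split zero    k f = refl
sum-split (suc a) k f = begin
  sumBelow (suc (a + k)) f
    ≡⟨ sum-front (a + k) f ⟩
  f 0 + sumBelow (a + k) (f ∘ suc)
    ≡⟨ cong (f 0 +_) (sum-split a k (f ∘ suc)) ⟩
  f 0 + (sumBelow a (f ∘ suc) + sumBelow k (λ i → f (suc (a + i))))
    ≡⟨ +-assoc (f 0) _ _ ⟨
  f 0 + sumBelow a (f ∘ suc) + sumBelow k (λ i → f (suc (a + i)))
    ≡⟨ cong (_+ sumBelow k (λ i → f (suc (a + i)))) (sum-front a f) ⟨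
  sumBelow (suc a) f + sumBelow k (λ i → f (suc (a + i))) ∎
  where open ≡-Reasoning

sum-window : ∀ a k n (f : ℕ → ℕ) → a + k ≤ n →
  (∀ i → i < a → f i ≡ 0) → (∀ i → a + k ≤ i → f i ≡ 0) →
  sumBelow n f ≡ sumBelow k (λ i → f (a + i))
sum-window a k n f a+k≤n below above = begin
  sumBelow n f
    ≡⟨ cong (λ m → sumBelow m f) (m+[n∸m]≡n a+k≤n) ⟨
  sumBelow (a + k + (n ∸ (a + k))) f
    ≡⟨ sum-split (a + k) (n ∸ (a + k)) f ⟩
  sumBelow (a + k) f + sumBelow (n ∸ (a + k)) (λ i → f (a + k + i))
    ≡⟨ cong₂ _+_ (sum-split a k f) (sum-0 (n ∸ (a + k)) λ i _ → above _ (m≤m+n (a + k) i)) ⟩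
  sumBelow a f + sumBelow k (λ i → f (a + i)) + 0
    ≡⟨ +-identityʳ _ ⟩
  sumBelow a f + sumBelow k (λ i → f (a + i))
    ≡⟨ cong (_+ sumBelow k (λ i → f (a + i))) (sum-0 a below) ⟩
  sumBelow k (λ i → f (a + i)) ∎
  where open ≡-Reasoning

sum-single : ∀ n x (f : ℕ → ℕ) → x < n → (∀ i → i ≢ x → f i ≡ 0) → sumBelow n f ≡ f x
sum-single n x f x<n h = begin
  sumBelow n f  ≡⟨ sum-window x 1 n f (subst (_≤ n) (+-comm 1 x) x<n)
                     (λ i i<x → h i (<⇒≢ i<x))
                     (λ i x+1≤i → h i λ { refl → <⇒≱ (≤-refl {suc i}) (subst (_≤ i) (+-comm i 1) x+1≤i) }) ⟩
  f (x + 0)     ≡⟨ cong f (+-identityʳ x) ⟩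
  f x           ∎
  where open ≡-Reasoning

-- Weights of lattice triangles.

box : ℕ → (ℕ → ℕ → ℕ) → ℕ
box n f = sumBelow n λ i → sumBelow n (f i)

box-cong : ∀ n {f g : ℕ → ℕ → ℕ} → (∀ i j → f i j ≡ g i j) → box n f ≡ box n g
box-cong n h = sum-cong n λ i _ → sum-cong n λ j _ → h i j

box-mono : ∀ n {f g : ℕ → ℕ → ℕ} → (∀ i j → f i j ≤ g i j) → box n f ≤ box n g
box-mono n h = sum-mono n λ i _ → sum-mono n λ j _ → h i j

box-+ : ∀ n (f g : ℕ → ℕ → ℕ) → box n (λ i j → f i j + g i j) ≡ box n f + box n g
box-+ n f g = trans (sum-cong n λ i _ → sum-+ n (f i) (g i)) (sum-+ n _ _)

-- The triangle with corner (a,b) bounded by i + j < d, of size d − a − b.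
In : ℕ → ℕ → ℕ → ℕ → ℕ → Set
In a b d i j = a ≤ i × b ≤ j × i + j < d

in? : ∀ a b d i j → Dec (In a b d i j)
in? a b d i j = (a ≤? i) ×-dec (b ≤? j) ×-dec (i + j <? d)

χ : ℕ → ℕ → ℕ → ℕ → ℕ → ℕ
χ a b d i j = ind (does (in? a b d i j))

χ-in : ∀ {a b d i j} → In a b d i j → χ a b d i j ≡ 1
χ-in {a} {b} {d} {i} {j} h = cong ind (dec-true (in? a b d i j) h)

χ-out : ∀ {a b d i j} → ¬ In a b d i j → χ a b d i j ≡ 0
χ-out {a} {b} {d} {i} {j} h = cong ind (dec-false (in? a b d i j) h)

ind≤1 : ∀ x → ind x ≤ 1
ind≤1 true  = ≤-refl
ind≤1 false = z≤n

χ-mono : ∀ {a b d i j a' b' d' i' j'} → (In a b d i j → In a' b' d' i' j') →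
  χ a b d i j ≤ χ a' b' d' i' j'
χ-mono {a} {b} {d} {i} {j} h with in? a b d i j
... | yes p = ≤-reflexive (trans (cong ind (dec-true (in? a b d i j) p)) (sym (χ-in (h p))))
... | no ¬p = subst (_≤ _) (sym (cong ind (dec-false (in? a b d i j) ¬p))) z≤n

-- All triangles are summed over the same n by n box against their indicators, so that weights of
-- different triangles can be compared term by term.
wt : ℕ → (ℕ → ℕ → ℕ) → ℕ → ℕ → ℕ → ℕ
wt n f a b d = box n λ i j → χ a b d i j * f i j

wt-cong-in : ∀ n {f g} a b d → (∀ i j → In a b d i j → f i j ≡ g i j) → wt n f a b d ≡ wt n g a b d
wt-cong-in n {f} {g} a b d h = box-cong n pointwise
  where
  pointwise : ∀ i j → χ a b d i j * f i j ≡ χ a b d i j * g i j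
  pointwise i j with in? a b d i j
  ... | yes p = cong (χ a b d i j *_) (h i j p)
  ... | no ¬p = trans (cong (_* f i j) (χ-out ¬p)) (sym (cong (_* g i j) (χ-out ¬p)))

wt-cong : ∀ n {f g} a b d → (∀ i j → f i j ≡ g i j) → wt n f a b d ≡ wt n g a b d
wt-cong n a b d h = wt-cong-in n a b d λ i j _ → h i j

wt-mono : ∀ n {f g} a b d → (∀ i j → f i j ≤ g i j) → wt n f a b d ≤ wt n g a b d
wt-mono n a b d h = box-mono n λ i j → *-monoʳ-≤ (χ a b d i j) (h i j)

wt-+ : ∀ n f g a b d → wt n (λ i j → f i j + g i j) a b d ≡ wt n f a b d + wt n g a b d
wt-+ n f g a b d = trans (box-cong n λ i j → *-distribˡ-+ (χ a b d i j) (f i j) (g i j)) (box-+ n _ _)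

wt-0 : ∀ n f a b d → (∀ i j → In a b d i j → f i j ≡ 0) → wt n f a b d ≡ 0
wt-0 n f a b d h = sum-0 n λ i _ → sum-0 n λ j _ → pointwise i j
  where
  pointwise : ∀ i j → χ a b d i j * f i j ≡ 0
  pointwise i j with in? a b d i j
  ... | yes p = trans (cong (χ a b d i j *_) (h i j p)) (*-zeroʳ (χ a b d i j))
  ... | no ¬p = cong (_* f i j) (χ-out ¬p)

-- Supermodularity. The right side has the join of the two triangles, with corner `(a',b)`, and
-- their intersection, with corner `(a,b')`. A cell of either triangle lies in the join, and a cell
-- of both also lies in the intersection.
wt-uncross : ∀ n f {a b d a' b' d'} → a' ≤ a → b ≤ b' →
  wt n f a b d + wt n f a' b' d' ≤ wt n f a' b (d ⊔ d') + wt n f a b' (d ⊓ d')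
wt-uncross n f {a} {b} {d} {a'} {b'} {d'} a'≤a b≤b' = begin
  wt n f a b d + wt n f a' b' d'
    ≡⟨ box-+ n _ _ ⟨
  box n (λ i j → χ a b d i j * f i j + χ a' b' d' i j * f i j)
    ≤⟨ box-mono n (λ i j → begin
         χ a b d i j * f i j + χ a' b' d' i j * f i j
           ≡⟨ *-distribʳ-+ (f i j) (χ a b d i j) _ ⟨
         (χ a b d i j + χ a' b' d' i j) * f i j
           ≤⟨ *-monoˡ-≤ (f i j) (pointwise i j) ⟩
         (χ a' b (d ⊔ d') i j + χ a b' (d ⊓ d') i j) * f i j
           ≡⟨ *-distribʳ-+ (f i j) (χ a' b (d ⊔ d') i j) _ ⟩
         χ a' b (d ⊔ d') i j * f i j + χ a b' (d ⊓ d') i j * f i j ∎) ⟩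
  box n (λ i j → χ a' b (d ⊔ d') i j * f i j + χ a b' (d ⊓ d') i j * f i j)
    ≡⟨ box-+ n _ _ ⟩
  wt n f a' b (d ⊔ d') + wt n f a b' (d ⊓ d') ∎
  where
  open ≤-Reasoning
  join₁ : ∀ {i j} → In a b d i j → In a' b (d ⊔ d') i j
  join₁ (p , q , r) = ≤-trans a'≤a p , q , <-≤-trans r (m≤m⊔n d d')
  join₂ : ∀ {i j} → In a' b' d' i j → In a' b (d ⊔ d') i j
  join₂ (p , q , r) = p , ≤-trans b≤b' q , <-≤-trans r (m≤n⊔m d d')
  pointwise : ∀ i j → χ a b d i j + χ a' b' d' i j ≤ χ a' b (d ⊔ d') i j + χ a b' (d ⊓ d') i j
  pointwise i j with in? a b d i j
  ... | no ¬p = ≤-trans (≤-reflexive (cong (_+ χ a' b' d' i j) (χ-out ¬p)))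
                  (≤-trans (χ-mono join₂) (m≤m+n _ _))
  ... | yes p with in? a' b' d' i j
  ...   | no ¬p' = ≤-trans (≤-reflexive (trans (cong (χ a b d i j +_) (χ-out ¬p')) (+-identityʳ _)))
                     (≤-trans (χ-mono join₁) (m≤m+n _ _))
  ...   | yes p' = +-mono-≤ (χ-mono join₁)
                     (χ-mono {a'} {b'} {d'} λ p'' → proj₁ p , proj₁ (proj₂ p'') , ⊓-glb (proj₂ (proj₂ p)) (proj₂ (proj₂ p'')))

-- Counts as weights; removing and inserting one element.

at : ℕ → ℕ → ℕ → ℕ → Bool
at p q i j = (i ≡ᵇ p) ∧ (j ≡ᵇ q)

at-refl : ∀ p q → at p q p q ≡ true
at-refl p q rewrite Equivalence.to T-≡ (≡⇒≡ᵇ p p refl) = Equivalence.to T-≡ (≡⇒≡ᵇ q q refl)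

at⇒≡ : ∀ p q i j → at p q i j ≡ true → i ≡ p × j ≡ q
at⇒≡ p q i j h with i ≡ᵇ p in e₁ | j ≡ᵇ q in e₂ | h
... | true | true | _ = ≡ᵇ⇒≡ i p (Equivalence.from T-≡ e₁) , ≡ᵇ⇒≡ j q (Equivalence.from T-≡ e₂)

at-≢ : ∀ p q i j → ¬ (i ≡ p × j ≡ q) → at p q i j ≡ false
at-≢ p q i j h with at p q i j in e
... | true  = contradiction (at⇒≡ p q i j e) h
... | false = refl

δ : ℕ → ℕ → ℕ → ℕ → ℕ
δ p q i j = ind (at p q i j)

wt-δ : ∀ n x y a b d → x < n → y < n → wt n (δ x y) a b d ≡ χ a b d x y
wt-δ n x y a b d x<n y<n = begin
  wt n (δ x y) a b d
    ≡⟨ sum-single n x _ x<n (λ i i≢x → sum-0 n λ j _ → off i j (i≢x ∘ proj₁)) ⟩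
  sumBelow n (λ j → χ a b d x j * δ x y x j)
    ≡⟨ sum-single n y _ y<n (λ j j≢y → off x j (j≢y ∘ proj₂)) ⟩
  χ a b d x y * δ x y x y
    ≡⟨ cong (λ v → χ a b d x y * ind v) (at-refl x y) ⟩
  χ a b d x y * 1
    ≡⟨ *-identityʳ _ ⟩
  χ a b d x y ∎
  where
  open ≡-Reasoning
  off : ∀ i j → ¬ (i ≡ x × j ≡ y) → χ a b d i j * δ x y i j ≡ 0
  off i j h = trans (cong (λ v → χ a b d i j * ind v) (at-≢ x y i j h)) (*-zeroʳ (χ a b d i j))

⟦_⟧ : USet → ℕ → ℕ → ℕ
⟦ s ⟧ i j = ind (s i j)

-- Passes from a triangle given by its size `k`, as in `cnt`, to the bound `a + b + k` used by `wt`.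
-- Because the triangle lies in T_n, the box contains all of it.
wtsum : ∀ n (f : ℕ → ℕ → ℕ) a b k → a + b + k ≤ n →
  sumBelow k (λ i → sumBelow (k ∸ i) (λ j → f (a + i) (b + j))) ≡ wt n f a b (a + b + k)
wtsum n f a b k d≤n = sym (begin
  wt n f a b d
    ≡⟨ sum-window a k n _ (≤-trans a+k≤d d≤n)
         (λ i i<a → sum-0 n λ j _ → off i j λ p → <⇒≱ i<a (proj₁ p))
         (λ i a+k≤i → sum-0 n λ j _ → off i j λ p → far i j a+k≤i (proj₂ p)) ⟩
  sumBelow k (λ i → sumBelow n λ j → F (a + i) j)
    ≡⟨ sum-cong k (λ i i<k → sum-window b (k ∸ i) n _
         (≤-trans (+-monoʳ-≤ b (m∸n≤m k i)) (≤-trans b+k≤d d≤n))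
         (λ j j<b → off (a + i) j λ p → <⇒≱ j<b (proj₁ (proj₂ p)))
         (λ j h → off (a + i) j λ p → far' i j (<⇒≤ i<k) h (proj₂ (proj₂ p)))) ⟩
  sumBelow k (λ i → sumBelow (k ∸ i) λ j → F (a + i) (b + j))
    ≡⟨ sum-cong k (λ i i<k → sum-cong (k ∸ i) λ j j<k∸i →
         trans (cong (_* f (a + i) (b + j)) (χ-in (inside i j (<⇒≤ i<k) j<k∸i))) (+-identityʳ _)) ⟩
  sumBelow k (λ i → sumBelow (k ∸ i) (λ j → f (a + i) (b + j))) ∎)
  where
  open ≡-Reasoning
  d = a + b + k
  F : ℕ → ℕ → ℕ
  F i j = χ a b d i j * f i j
  off : ∀ i j → ¬ In a b d i j → F i j ≡ 0
  off i j h = cong (_* f i j) (χ-out h)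
  a+k≤d : a + k ≤ a + b + k
  a+k≤d = +-monoˡ-≤ k (m≤m+n a b)
  b+k≤d : b + k ≤ a + b + k
  b+k≤d = +-monoˡ-≤ k (m≤n+m b a)
  far : ∀ i j → a + k ≤ i → ¬ (b ≤ j × i + j < a + b + k)
  far i j p (q , r) = absurd 0 (+-mono-≤ (+-mono-≤ p q) r) (aux a b k i j)
    where
    aux : ∀ a b k i j → a + k + b + suc (i + j) ≡ suc (i + j + (a + b + k) + 0)
    aux = solve-∀
  far' : ∀ i j → i ≤ k → b + (k ∸ i) ≤ j → ¬ (a + i + j < a + b + k)
  far' i j i≤k p r = <⇒≱ r (subst (λ k → a + b + k ≤ a + i + j) (m+[n∸m]≡n i≤k)
    (lin 0 p (aux a b i j (k ∸ i))))
    where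
    aux : ∀ a b i j m → a + b + (i + m) + j + 0 ≡ a + i + j + (b + m)
    aux = solve-∀
  inside : ∀ i j → i ≤ k → j < k ∸ i → In a b d (a + i) (b + j)
  inside i j i≤k p = m≤m+n a i , m≤m+n b j ,
    subst (λ k → a + i + (b + j) < a + b + k) (m+[n∸m]≡n i≤k) (lin 0 p (aux a b i j (k ∸ i)))
    where
    aux : ∀ a b i j m → suc (a + i + (b + j)) + m + 0 ≡ a + b + (i + m) + suc j
    aux = solve-∀

cnt≡wt : ∀ n s a b k → a + b + k ≤ n → cnt s a b k ≡ wt n ⟦ s ⟧ a b (a + b + k)
cnt≡wt n s = wtsum n ⟦ s ⟧

remove : USet → ℕ → ℕ → USet
remove s p q i j = s i j ∧ not (at p q i j)

insert : USet → ℕ → ℕ → USet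
insert s p q i j = s i j ∨ at p q i j

move : USet → ℕ → ℕ → ℕ → ℕ → USet
move s p q x y = insert (remove s p q) x y

remove-at : ∀ s p q → remove s p q p q ≡ false
remove-at s p q rewrite at-refl p q = ∧-zeroʳ (s p q)

remove-off : ∀ s p q i j → ¬ (i ≡ p × j ≡ q) → remove s p q i j ≡ s i j
remove-off s p q i j h rewrite at-≢ p q i j h = ∧-identityʳ (s i j)

insert-at : ∀ s p q → insert s p q p q ≡ true
insert-at s p q rewrite at-refl p q = ∨-zeroʳ (s p q)

insert-off : ∀ s p q i j → ¬ (i ≡ p × j ≡ q) → insert s p q i j ≡ s i j
insert-off s p q i j h rewrite at-≢ p q i j h = ∨-identityʳ (s i j)

remove-⟦⟧ : ∀ s p q → s p q ≡ true → ∀ i j → ⟦ remove s p q ⟧ i j + δ p q i j ≡ ⟦ s ⟧ i j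
remove-⟦⟧ s p q h i j with at p q i j in e
... | false = trans (+-identityʳ _) (cong ind (∧-identityʳ (s i j)))
... | true with refl , refl ← at⇒≡ p q i j e = cong₂ (λ v w → ind v + w) (∧-zeroʳ (s i j)) (sym (cong ind h))

insert-⟦⟧ : ∀ s p q → s p q ≡ false → ∀ i j → ⟦ insert s p q ⟧ i j ≡ ⟦ s ⟧ i j + δ p q i j
insert-⟦⟧ s p q h i j with at p q i j in e
... | false = trans (cong ind (∨-identityʳ (s i j))) (sym (+-identityʳ _))
... | true with refl , refl ← at⇒≡ p q i j e = trans (cong ind (∨-zeroʳ (s i j))) (sym (cong (λ v → ind v + 1) h))

module _ {n : ℕ} where

  wt-remove : ∀ s p q a b d → s p q ≡ true → p + q < n →
    wt n ⟦ remove s p q ⟧ a b d + χ a b d p q ≡ wt n ⟦ s ⟧ a b d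
  wt-remove s p q a b d h p+q<n = begin
    wt n ⟦ remove s p q ⟧ a b d + χ a b d p q
      ≡⟨ cong (wt n ⟦ remove s p q ⟧ a b d +_) (wt-δ n p q a b d (≤-<-trans (m≤m+n p q) p+q<n) (≤-<-trans (m≤n+m q p) p+q<n)) ⟨
    wt n ⟦ remove s p q ⟧ a b d + wt n (δ p q) a b d
      ≡⟨ wt-+ n ⟦ remove s p q ⟧ (δ p q) a b d ⟨
    wt n (λ i j → ⟦ remove s p q ⟧ i j + δ p q i j) a b d
      ≡⟨ wt-cong n a b d (remove-⟦⟧ s p q h) ⟩
    wt n ⟦ s ⟧ a b d ∎
    where open ≡-Reasoning

  wt-insert : ∀ s p q a b d → s p q ≡ false → p + q < n →
    wt n ⟦ insert s p q ⟧ a b d ≡ wt n ⟦ s ⟧ a b d + χ a b d p q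
  wt-insert s p q a b d h p+q<n = begin
    wt n ⟦ insert s p q ⟧ a b d
      ≡⟨ wt-cong n a b d (insert-⟦⟧ s p q h) ⟩
    wt n (λ i j → ⟦ s ⟧ i j + δ p q i j) a b d
      ≡⟨ wt-+ n ⟦ s ⟧ (δ p q) a b d ⟩
    wt n ⟦ s ⟧ a b d + wt n (δ p q) a b d
      ≡⟨ cong (wt n ⟦ s ⟧ a b d +_) (wt-δ n p q a b d (≤-<-trans (m≤m+n p q) p+q<n) (≤-<-trans (m≤n+m q p) p+q<n)) ⟩
    wt n ⟦ s ⟧ a b d + χ a b d p q ∎
    where open ≡-Reasoning

-- Independence, saturated triangles and the exchange property.

Ind : ℕ → USet → Set
Ind n s = ∀ a b d → a + b ≤ d → d ≤ n → wt n ⟦ s ⟧ a b d + (a + b) ≤ d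

Over : ℕ → USet → ℕ → ℕ → ℕ → Set
Over n s a b d = a + b ≤ d × d ≤ n × d < wt n ⟦ s ⟧ a b d + (a + b)

-- A saturated triangle; the empty ones (d ≡ a + b) count as saturated.
Tight : ℕ → USet → ℕ → ℕ → ℕ → Set
Tight n s a b d = a + b ≤ d × d ≤ n × d ≤ wt n ⟦ s ⟧ a b d + (a + b)

-- Decided by a finite search, since `a + b ≤ d ≤ n` bounds all three parameters.
Ind⊎Over : ∀ n s → Ind n s ⊎ ∃[ a ] ∃[ b ] ∃[ d ] Over n s a b d
Ind⊎Over n s with
  anyUpTo? (λ d → anyUpTo? (λ a → anyUpTo? (λ b →
    (a + b ≤? d) ×-dec (d <? wt n ⟦ s ⟧ a b d + (a + b))) (suc d)) (suc d)) (suc n)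
... | yes (d , d<1+n , a , _ , b , _ , p , q) = inj₂ (a , b , d , p , ≤-pred d<1+n , q)
... | no h = inj₁ λ a b d p d≤n → ≮⇒≥ λ q →
  h (d , s≤s d≤n , a , s≤s (≤-trans (m≤m+n a b) p) , b , s≤s (≤-trans (m≤n+m b a) p) , p , q)

module _ {n : ℕ} where

  remove-Ind : ∀ s p q → Ind n s → Ind n (remove s p q)
  remove-Ind s p q I a b d h d≤n =
    ≤-trans (+-monoˡ-≤ (a + b) (wt-mono n a b d λ i j → pointwise i j)) (I a b d h d≤n)
    where
    pointwise : ∀ i j → ⟦ remove s p q ⟧ i j ≤ ⟦ s ⟧ i j
    pointwise i j with s i j | at p q i j
    ... | false | _     = z≤n
    ... | true  | false = ≤-refl
    ... | true  | true  = z≤n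

  -- Putting `(p,q)` back into a saturated triangle that contains it would over-saturate that
  -- triangle, against the independence of `s`.
  tight-avoids : ∀ s p q a b d → Ind n s → s p q ≡ true → p + q < n →
    Tight n (remove s p q) a b d → ¬ In a b d p q
  tight-avoids s p q a b d I h p+q<n (a+b≤d , d≤n , t) pq∈T =
    absurd 0 (+-mono-≤ (≤-trans (≤-reflexive (cong (_+ (a + b)) wt-suc)) (I a b d a+b≤d d≤n)) t)
      (aux (wt n ⟦ remove s p q ⟧ a b d) a b d)
    where
    wt-suc : wt n ⟦ remove s p q ⟧ a b d + 1 ≡ wt n ⟦ s ⟧ a b d
    wt-suc = trans (cong (wt n ⟦ remove s p q ⟧ a b d +_) (sym (χ-in pq∈T))) (wt-remove s p q a b d h p+q<n)
    aux : ∀ w a b d → w + 1 + (a + b) + d ≡ suc (d + (w + (a + b)) + 0)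
    aux = solve-∀

  -- The sizes of join and intersection add up to those of the two triangles, and by `wt-uncross`
  -- their weights add up to at least as much as before. Independence bounds the weight of the
  -- intersection by its size, so the join must reach its own. The hypothesis `a + b' ≤ d ⊓ d'` says
  -- that the intersection is a triangle, possibly empty.
  tight-join : ∀ {s a b d a' b' d'} → Ind n s → a' ≤ a → b ≤ b' → a + b' ≤ d ⊓ d' →
    Tight n s a b d → Tight n s a' b' d' → Tight n s a' b (d ⊔ d')
  tight-join {s} {a} {b} {d} {a'} {b'} {d'} I a'≤a b≤b' meet (p , d≤n , t) (p' , d'≤n , t') =
    ≤-trans (+-mono-≤ a'≤a ≤-refl) (≤-trans p (m≤m⊔n d d')) , ⊔-lub d≤n d'≤n ,
    bound (wt n ⟦ s ⟧ a b d) (wt n ⟦ s ⟧ a' b' d') (wt n ⟦ s ⟧ a' b (d ⊔ d')) (wt n ⟦ s ⟧ a b' (d ⊓ d')) _ _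
      (⊓⊔ d d') t t' (wt-uncross n ⟦ s ⟧ {d = d} {d' = d'} a'≤a b≤b')
      (I a b' (d ⊓ d') meet (≤-trans (m⊓n≤m d d') d≤n))
    where
    ⊓⊔ : ∀ d d' → d ⊓ d' + (d ⊔ d') ≡ d + d'
    ⊓⊔ d d' with ≤-total d d'
    ... | inj₁ h = cong₂ _+_ (m≤n⇒m⊓n≡m h) (m≤n⇒m⊔n≡n h)
    ... | inj₂ h = trans (cong₂ _+_ (m≥n⇒m⊓n≡n h) (m≥n⇒m⊔n≡m h)) (+-comm d' d)
    bound : ∀ w w' u v m j → m + j ≡ d + d' → d ≤ w + (a + b) → d' ≤ w' + (a' + b') →
      w + w' ≤ u + v → v + (a + b') ≤ m → j ≤ u + (a' + b)
    bound w w' u v m j eq h h' k l =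
      lin 0 (+-mono-≤ (+-mono-≤ h h') (+-mono-≤ (+-mono-≤ k l) (≤-reflexive eq)))
        (aux w w' u v m j d d' a b a' b')
      where
      aux : ∀ w w' u v m j d d' a b a' b' →
        j + (w + (a + b) + (w' + (a' + b')) + (u + v + m + (d + d'))) + 0 ≡
        u + (a' + b) + (d + d' + (w + w' + (v + (a + b'))  + (m + j)))
      aux = solve-∀

  -- The obstruction to adding `(x,y)` is a saturated triangle around it. If `(x,y)` is already
  -- present, this is its own unit triangle. Otherwise it is a triangle over-saturated by the
  -- insertion, which contains `(x,y)` because the weight of every other triangle is unchanged.
  insert-or-tight : ∀ r x y → Ind n r → x + y < n →
    (r x y ≡ false × Ind n (insert r x y)) ⊎ ∃[ a ] ∃[ b ] ∃[ d ] (Tight n r a b d × In a b d x y)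
  insert-or-tight r x y I x+y<n with r x y in e
  ... | true = inj₂ (x , y , suc (x + y) ,
          (n≤1+n _ , x+y<n , +-monoˡ-≤ (x + y) (subst (_≤ wt n ⟦ r ⟧ x y (suc (x + y))) (χ-in corner∈) χ≤wt)) , corner∈)
    where
    corner∈ : In x y (suc (x + y)) x y
    corner∈ = ≤-refl , ≤-refl , ≤-refl
    χ≤wt : χ x y (suc (x + y)) x y ≤ wt n ⟦ r ⟧ x y (suc (x + y))
    χ≤wt = subst (χ x y (suc (x + y)) x y ≤_) (wt-remove r x y x y (suc (x + y)) e x+y<n)
      (m≤n+m (χ x y (suc (x + y)) x y) (wt n ⟦ remove r x y ⟧ x y (suc (x + y))))
  ... | false with Ind⊎Over n (insert r x y)
  ...   | inj₁ I' = inj₁ (refl , I')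
  ...   | inj₂ (a , b , d , p , d≤n , o) with in? a b d x y
  ...     | yes xy∈T = inj₂ (a , b , d , (p , d≤n , tight) , xy∈T)
    where
    tight : d ≤ wt n ⟦ r ⟧ a b d + (a + b)
    tight = bound (wt n ⟦ r ⟧ a b d) _ (trans (wt-insert r x y a b d e x+y<n) (cong (wt n ⟦ r ⟧ a b d +_) (χ-in xy∈T))) o
      where
      bound : ∀ w w' → w' ≡ w + 1 → d < w' + (a + b) → d ≤ w + (a + b)
      bound w .(w + 1) refl h = lin 0 h (aux w d a b)
        where
        aux : ∀ w d a b → d + (w + 1 + (a + b)) + 0 ≡ w + (a + b) + suc d
        aux = solve-∀
  ...     | no xy∉T = ⊥-elim (<⇒≱ o (subst (λ w → w + (a + b) ≤ d)
              (sym (trans (wt-insert r x y a b d e x+y<n)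
                (trans (cong (wt n ⟦ r ⟧ a b d +_) (χ-out xy∉T)) (+-identityʳ _))))
              (I a b d p d≤n)))

  -- If both moves were blocked, by saturated triangles T and T' avoiding (p,q),
  -- then T would start in column p + 1 and T' in row q + 1, and their join,
  -- which is again saturated, would contain (p,q).
  exchange : ∀ s p q → Ind n s → s p q ≡ true → suc (suc (p + q)) ≤ n →
    (s (suc p) q ≡ false × Ind n (move s p q (suc p) q)) ⊎
    (s p (suc q) ≡ false × Ind n (move s p q p (suc q)))
  exchange s p q I h bound
    with insert-or-tight (remove s p q) (suc p) q (remove-Ind s p q I) bound
       | insert-or-tight (remove s p q) p (suc q) (remove-Ind s p q I) (subst (_< n) (sym (+-suc p q)) bound)
  ... | inj₁ (e , I') | _ = inj₁ (trans (sym (remove-off s p q _ _ (1+n≢n ∘ proj₁))) e , I')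
  ... | inj₂ _ | inj₁ (e , I') = inj₂ (trans (sym (remove-off s p q _ _ (1+n≢n ∘ proj₂))) e , I')
  ... | inj₂ (a , b , d , t , (a≤ , b≤ , <d)) | inj₂ (a' , b' , d' , t' , (a'≤ , b'≤ , <d')) =
    ⊥-elim (avoid _ _ _ joined (a'≤ , b≤ , <-≤-trans (<-trans (n<1+n _) <d) (m≤m⊔n d d')))
    where
    avoid : ∀ a b d → Tight n (remove s p q) a b d → ¬ In a b d p q
    avoid a b d = tight-avoids s p q a b d I h (<-trans (n<1+n _) bound)
    p<a : p < a
    p<a = ≰⇒> λ a≤p → avoid a b d t (a≤p , b≤ , <-trans (n<1+n _) <d)
    q<b' : q < b'
    q<b' = ≰⇒> λ b'≤q → avoid a' b' d' t' (a'≤ , b'≤q , <-trans (n<1+n _) (subst (_< d') (+-suc p q) <d'))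
    a≡ : a ≡ suc p
    a≡ = ≤-antisym a≤ p<a
    b'≡ : b' ≡ suc q
    b'≡ = ≤-antisym b'≤ q<b'
    -- Each triangle contains a cell with coordinate sum `p + q + 1`, so both bounds are at least
    -- `p + q + 2`, which is the corner sum `a + b'` of the intersection.
    joined : Tight n (remove s p q) a' b (d ⊔ d')
    joined = tight-join (remove-Ind s p q I) (≤-trans a'≤ (<⇒≤ p<a)) (≤-trans b≤ (<⇒≤ q<b'))
      (⊓-glb (subst₂ (λ x y → x + y ≤ d) (sym a≡) (sym b'≡) (subst (_≤ d) (cong suc (sym (+-suc p q))) <d))
             (subst₂ (λ x y → x + y ≤ d') (sym a≡) (sym b'≡) <d'))
      t t'

wt-⊆ : ∀ n f a b d a' b' d' → (∀ i j → In a b d i j → In a' b' d' i j ⊎ f i j ≡ 0) →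
  wt n f a b d ≤ wt n f a' b' d'
wt-⊆ n f a b d a' b' d' h = box-mono n pointwise
  where
  pointwise : ∀ i j → χ a b d i j * f i j ≤ χ a' b' d' i j * f i j
  pointwise i j with in? a b d i j
  ... | no ¬p = subst (_≤ χ a' b' d' i j * f i j) (sym (cong (_* f i j) (χ-out ¬p))) z≤n
  ... | yes p with h i j p
  ...   | inj₁ p' = ≤-reflexive (cong (_* f i j) (trans (χ-in p) (sym (χ-in p'))))
  ...   | inj₂ e = subst (_≤ χ a' b' d' i j * f i j) (sym (trans (cong (χ a b d i j *_) e) (*-zeroʳ (χ a b d i j)))) z≤n

-- Exact coverings of regions by tiles.

infix 4 _≟ᵤ_
_≟ᵤ_ : DecidableEquality UT
up i j   ≟ᵤ up k l   = map′ (λ { (refl , refl) → refl }) (λ { refl → refl , refl }) ((i ≟ k) ×-dec (j ≟ l))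
up i j   ≟ᵤ down k l = no λ ()
down i j ≟ᵤ up k l   = no λ ()
down i j ≟ᵤ down k l = map′ (λ { (refl , refl) → refl }) (λ { refl → refl , refl }) ((i ≟ k) ×-dec (j ≟ l))

eqUT-refl : ∀ t → eqUT t t ≡ true
eqUT-refl (up i j)   = at-refl i j
eqUT-refl (down i j) = at-refl i j

eqUT-≢ : ∀ t u → t ≢ u → eqUT t u ≡ false
eqUT-≢ (up i j)   (up k l)   h = at-≢ k l i j λ { (refl , refl) → h refl }
eqUT-≢ (up i j)   (down k l) h = refl
eqUT-≢ (down i j) (up k l)   h = refl
eqUT-≢ (down i j) (down k l) h = at-≢ k l i j λ { (refl , refl) → h refl }

count : UT → List UT → ℕ
count t us = sum (map (λ u → ind (eqUT t u)) us)

count-∉ : ∀ t us → t ∉ us → count t us ≡ 0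
count-∉ t []       h = refl
count-∉ t (u ∷ us) h = cong₂ (λ v w → ind v + w) (eqUT-≢ t u (h ∘ here)) (count-∉ t us (h ∘ there))

count-∈ : ∀ t us → t ∈ us → 1 ≤ count t us
count-∈ t (u ∷ us) (here refl) rewrite eqUT-refl t = s≤s z≤n
count-∈ t (u ∷ us) (there h) = ≤-trans (count-∈ t us h) (m≤n+m _ _)

count-unique : ∀ t us → Unique us → t ∈ us → count t us ≡ 1
count-unique t (u ∷ us) (u≢ AllPairs.∷ _) (here refl) = cong₂ (λ v w → ind v + w) (eqUT-refl t) (count-∉ t us (∉-of u≢))
  where
  ∉-of : ∀ {us} → All (t ≢_) us → t ∉ us
  ∉-of (h ∷ _) (here e)  = h e
  ∉-of (_ ∷ h) (there m) = ∉-of h m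
count-unique t (u ∷ us) (u≢ AllPairs.∷ U) (there h) =
  cong₂ (λ v w → ind v + w) (eqUT-≢ t u (≢-of u≢ h)) (count-unique t us U h)
  where
  ≢-of : ∀ {u us} → All (u ≢_) us → t ∈ us → t ≢ u
  ≢-of (h ∷ _) (here refl) = h ∘ sym
  ≢-of (_ ∷ h) (there m)   = ≢-of h m

open import Data.List.Membership.DecPropositional _≟ᵤ_ using (_∈?_)

-- The region is an arbitrary predicate so that half-swept triangles can be described. Each
-- alternative also decides membership, and cells outside the region have multiplicity zero.
Cov : (UT → Set) → List Tile → Set
Cov P ts = ∀ t → (P t × occ t ts ≡ 1) ⊎ (¬ P t × occ t ts ≡ 0)

cov-⇔ : ∀ {P Q ts} → (∀ t → P t → Q t) → (∀ t → Q t → P t) → Cov P ts → Cov Q ts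
cov-⇔ f g cov t with cov t
... | inj₁ (p , e)  = inj₁ (f t p , e)
... | inj₂ (¬p , e) = inj₂ (¬p ∘ g t , e)

-- Here `P'` is what remains of `P` once `τ` is laid. The cells of `τ` must be distinct because
-- `occ` counts with multiplicity.
cov-∷ : ∀ {P P' ts} τ → Unique (cells τ) → All (λ t → P t × ¬ P' t) (cells τ) →
  (∀ t → t ∉ cells τ → P t → P' t) → (∀ t → t ∉ cells τ → P' t → P t) →
  Cov P' ts → Cov P (τ ∷ ts)
cov-∷ {P} {P'} {ts} τ U new old old' cov t with t ∈? cells τ
... | yes t∈ = [ (λ (p' , _) → contradiction p' (proj₂ both)) ,
                 (λ (_ , e) → inj₁ (proj₁ both , cong₂ _+_ (count-unique t (cells τ) U t∈) e)) ]′ (cov t)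
  where
  lookup : ∀ {us} → All (λ t → P t × ¬ P' t) us → t ∈ us → P t × ¬ P' t
  lookup (h ∷ _) (here refl) = h
  lookup (_ ∷ h) (there m)   = lookup h m
  both = lookup new t∈
... | no t∉ = [ (λ (p' , e) → inj₁ (old' t t∉ p' , cong₂ _+_ (count-∉ t (cells τ) t∉) e)) ,
                (λ (¬p' , e) → inj₂ (¬p' ∘ old t t∉ , cong₂ _+_ (count-∉ t (cells τ) t∉) e)) ]′ (cov t)

-- Rhombus tilings of saturated triangles.

-- The three upward neighbours of a downward triangle: `A` to its left and `B` to its right in the
-- same row, `C` above it.
data Dir : Set where
  A B C : Dir

rhomb : Dir → ℕ → ℕ → Tile
rhomb A = rhombA
rhomb B = rhombB
rhomb C = rhombC

nbX nbY : Dir → ℕ → ℕ → ℕ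
nbX A i j = i
nbX B i j = suc i
nbX C i j = i
nbY A i j = j
nbY B i j = j
nbY C i j = suc j

nb : Dir → ℕ → ℕ → UT
nb r i j = up (nbX r i j) (nbY r i j)

cells-rhomb : ∀ r i j → cells (rhomb r i j) ≡ down i j ∷ nb r i j ∷ []
cells-rhomb A i j = refl
cells-rhomb B i j = refl
cells-rhomb C i j = refl

rhomb-unique : ∀ {i j x y} → Unique (down i j ∷ up x y ∷ [])
rhomb-unique = ((λ ()) ∷ []) AllPairs.∷ [] AllPairs.∷ AllPairs.[]

IsRhomb : Tile → Set
IsRhomb τ = ∃[ r ] ∃[ i ] ∃[ j ] τ ≡ rhomb r i j

-- What the row-by-row sweep still has to tile when it has reached the down
-- triangle (p,q), in the triangle with left column a and bound d.
Rest : ℕ → ℕ → ℕ → ℕ → ℕ → Set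
Rest a q p i j = (j ≡ q × p ≤ i) ⊎ (q < j × a ≤ i)

RestTiles : ℕ → ℕ → ℕ → ℕ → USet → UT → Set
RestTiles a d q p c (up i j)   = Rest a q p i j × i + j < d × c i j ≡ false
RestTiles a d q p c (down i j) = Rest a q p i j × suc (i + j) < d

Rest-step : ∀ {a q p i j} → ¬ (i ≡ p × j ≡ q) → Rest a q p i j → Rest a q (suc p) i j
Rest-step h (inj₁ (refl , p≤i)) = inj₁ (refl , ≤∧≢⇒< p≤i λ { refl → h (refl , refl) })
Rest-step h (inj₂ r) = inj₂ r

Rest-back : ∀ {a q p i j} → Rest a q (suc p) i j → Rest a q p i j
Rest-back (inj₁ (e , p<i)) = inj₁ (e , <⇒≤ p<i)
Rest-back (inj₂ r) = inj₂ r

Rest-done : ∀ {a q p} → ¬ Rest a q (suc p) p q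
Rest-done (inj₁ (_ , h)) = <-irrefl refl h
Rest-done (inj₂ (h , _)) = <-irrefl refl h

module _ {a d q p : ℕ} where

  cov-rhombA : ∀ {c ts} → c p q ≡ false → suc (p + q) < d →
    Cov (RestTiles a d q (suc p) c) ts → Cov (RestTiles a d q p c) (rhombA p q ∷ ts)
  cov-rhombA {c} {ts} e h = cov-∷ {ts = ts} (rhombA p q) rhomb-unique
    (((inj₁ (refl , ≤-refl) , h) , Rest-done ∘ proj₁) ∷
     ((inj₁ (refl , ≤-refl) , <-trans (n<1+n _) h , e) , Rest-done ∘ proj₁) ∷ [])
    old old'
    where
    old : ∀ t → t ∉ cells (rhombA p q) → RestTiles a d q p c t → RestTiles a d q (suc p) c t
    old (up i j)   t∉ (r , z) = Rest-step (λ { (refl , refl) → t∉ (there (here refl)) }) r , z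
    old (down i j) t∉ (r , z) = Rest-step (λ { (refl , refl) → t∉ (here refl) }) r , z
    old' : ∀ t → t ∉ cells (rhombA p q) → RestTiles a d q (suc p) c t → RestTiles a d q p c t
    old' (up i j)   t∉ (r , z) = Rest-back r , z
    old' (down i j) t∉ (r , z) = Rest-back r , z

  -- The neighbour `(x,y)` is covered by the rhombus, so the rest of the sweep has to treat it as a
  -- hole, while the hole `(p,q)` has been passed. Both effects together are exactly `move`.
  cov-move : ∀ {c ts} r → let x = nbX r p q; y = nbY r p q in
    c p q ≡ true → c x y ≡ false → Rest a q p x y → x + y ≡ suc (p + q) → suc (p + q) < d →
    Cov (RestTiles a d q (suc p) (move c p q x y)) ts → Cov (RestTiles a d q p c) (rhomb r p q ∷ ts)
  cov-move {c} {ts} r ct cf rest xy h = cov-∷ {ts = ts} (rhomb r p q)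
    (subst Unique (sym (cells-rhomb r p q)) rhomb-unique)
    (subst (All _) (sym (cells-rhomb r p q))
      (((inj₁ (refl , ≤-refl) , h) , Rest-done ∘ proj₁) ∷
       ((rest , subst (_< d) (sym xy) h , cf) ,
         λ (_ , _ , e) → contradiction (trans (sym (insert-at (remove c p q) x y)) e) λ ()) ∷ []))
    (subst (λ us → ∀ t → t ∉ us → RestTiles a d q p c t → RestTiles a d q (suc p) c' t) (sym (cells-rhomb r p q)) old)
    (subst (λ us → ∀ t → t ∉ us → RestTiles a d q (suc p) c' t → RestTiles a d q p c t) (sym (cells-rhomb r p q)) old')
    where
    x = nbX r p q
    y = nbY r p q
    c' = move c p q x y
    off : ∀ i j → up i j ∉ down p q ∷ nb r p q ∷ [] → ¬ (i ≡ p × j ≡ q) → c' i j ≡ c i j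
    off i j t∉ ij≢ = trans (insert-off (remove c p q) x y i j λ { (refl , refl) → t∉ (there (here refl)) })
                           (remove-off c p q i j ij≢)
    old : ∀ t → t ∉ down p q ∷ nb r p q ∷ [] → RestTiles a d q p c t → RestTiles a d q (suc p) c' t
    old (up i j) t∉ (r , b , e) = Rest-step ij≢ r , b , trans (off i j t∉ ij≢) e
      where
      ij≢ : ¬ (i ≡ p × j ≡ q)
      ij≢ (refl , refl) = contradiction (trans (sym ct) e) λ ()
    old (down i j) t∉ (r , z) = Rest-step (λ { (refl , refl) → t∉ (here refl) }) r , z
    old' : ∀ t → t ∉ down p q ∷ nb r p q ∷ [] → RestTiles a d q (suc p) c' t → RestTiles a d q p c t
    old' (up i j)   t∉ (r , b , e) = Rest-back r , b , trans (sym (off i j t∉ λ { (refl , refl) → Rest-done r })) e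
    old' (down i j) t∉ (r , z) = Rest-back r , z

  -- The last upward triangle of a row has no downward triangle to its right. As it is a hole,
  -- nothing in the row remains to be tiled and the sweep continues one row up.
  cov-row-end : ∀ {c ts} → c p q ≡ true → suc (p + q) ≡ d → a ≤ p →
    Cov (RestTiles a d (suc q) a c) ts → Cov (RestTiles a d q p c) ts
  cov-row-end {c} {ts} ct refl a≤p = cov-⇔ {ts = ts} to from
    where
    from : ∀ t → RestTiles a d q p c t → RestTiles a d (suc q) a c t
    from (up i j) (inj₁ (refl , p≤i) , b , e)
      with refl ← ≤-antisym p≤i (≤-pred (+-cancelʳ-< q i (suc p) b)) = contradiction (trans (sym ct) e) λ ()
    from (up i j) (inj₂ (q<j , a≤i) , z) = above , z
      where
      above : Rest a (suc q) a i j
      above with suc q ≟ j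
      ... | yes refl = inj₁ (refl , a≤i)
      ... | no ≢     = inj₂ (≤∧≢⇒< q<j ≢ , a≤i)
    from (down i j) (inj₁ (refl , p≤i) , b) = ⊥-elim (<⇒≱ b (s≤s (+-monoˡ-≤ q p≤i)))
    from (down i j) (inj₂ (q<j , a≤i) , z) = above , z
      where
      above : Rest a (suc q) a i j
      above with suc q ≟ j
      ... | yes refl = inj₁ (refl , a≤i)
      ... | no ≢     = inj₂ (≤∧≢⇒< q<j ≢ , a≤i)
    below : ∀ {i j} → Rest a (suc q) a i j → Rest a q p i j
    below (inj₁ (refl , h)) = inj₂ (≤-refl , h)
    below (inj₂ (l , h)) = inj₂ (<-trans (n<1+n q) l , h)
    to : ∀ t → RestTiles a d (suc q) a c t → RestTiles a d q p c t
    to (up i j)   (r , z) = below r , z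
    to (down i j) (r , z) = below r , z

RhombTiled : (UT → Set) → Set
RhombTiled P = ∃[ ts ] (All IsRhomb ts × Cov P ts)

module _ {n a d : ℕ} where

  -- Both ends of the move lie in the triangle, so its weight does not change.
  move-Tight : ∀ {c p q x y b} → c p q ≡ true → p + q < n → c x y ≡ false → x + y < n →
    In a b d p q → In a b d x y → Tight n c a b d → Tight n (move c p q x y) a b d
  move-Tight {c} {p} {q} {x} {y} {b} ct pq<n cf xy<n pq∈ xy∈ (h , d≤n , t) =
    h , d≤n , subst (λ w → d ≤ w + (a + b)) (sym same) t
    where
    open ≡-Reasoning
    r = remove c p q
    same : wt n ⟦ move c p q x y ⟧ a b d ≡ wt n ⟦ c ⟧ a b d
    same = begin
      wt n ⟦ insert r x y ⟧ a b d       ≡⟨ wt-insert r x y a b d (cong (_∧ _) cf) xy<n ⟩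
      wt n ⟦ r ⟧ a b d + χ a b d x y    ≡⟨ cong (wt n ⟦ r ⟧ a b d +_) (trans (χ-in xy∈) (sym (χ-in pq∈))) ⟩
      wt n ⟦ r ⟧ a b d + χ a b d p q    ≡⟨ wt-remove c p q a b d ct pq<n ⟩
      wt n ⟦ c ⟧ a b d                  ∎

  move-empty : ∀ {c p q x y} → (∀ i → a ≤ i → i < p → c i q ≡ false) →
    (∀ i → i ≤ p → ¬ (i ≡ x × q ≡ y)) → ∀ i → a ≤ i → i < suc p → move c p q x y i q ≡ false
  move-empty {c} {p} {q} {x} {y} empty off i a≤i i<1+p with i ≟ p
  ... | yes refl = trans (insert-off (remove c p q) x y p q (off p ≤-refl)) (remove-at c p q)
  ... | no i≢p = trans (insert-off (remove c p q) x y i q (off i (≤-pred i<1+p)))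
                   (trans (remove-off c p q i q (i≢p ∘ proj₁)) (empty i a≤i (≤∧≢⇒< (≤-pred i<1+p) i≢p)))

  drop-row : ∀ s q → (∀ i → a ≤ i → i + q < d → s i q ≡ false) → wt n ⟦ s ⟧ a q d ≤ wt n ⟦ s ⟧ a (suc q) d
  drop-row s q empty = wt-⊆ n ⟦ s ⟧ a q d a (suc q) d pointwise
    where
    pointwise : ∀ i j → In a q d i j → In a (suc q) d i j ⊎ ⟦ s ⟧ i j ≡ 0
    pointwise i j (a≤i , q≤j , b) with q ≟ j
    ... | yes refl = inj₂ (cong ind (empty i a≤i b))
    ... | no q≢j   = inj₁ (a≤i , ≤∧≢⇒< q≤j q≢j , b)

  -- If the last cell of the row were no hole either, the triangle above, smaller by one, would
  -- carry the full weight and violate independence. So that cell is a hole, and dropping the row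
  -- lowers size and weight by one each, which keeps saturation.
  row-end : ∀ {c p q} → suc (p + q) ≡ d → a ≤ p → Ind n c → Tight n c a q d →
    (∀ i → a ≤ i → i < p → c i q ≡ false) → c p q ≡ true × Tight n c a (suc q) d
  row-end {c} {p} {q} refl a≤p I (_ , d≤n , t) empty with c p q in e
  ... | false = ⊥-elim (absurd 0 (+-mono-≤ t (+-mono-≤ (drop-row c q row) (I a (suc q) (suc (p + q)) size d≤n)))
                 (aux p q a (wt n ⟦ c ⟧ a q d) (wt n ⟦ c ⟧ a (suc q) d)))
    where
    size : a + suc q ≤ suc (p + q)
    size = subst (a + suc q ≤_) (+-suc p q) (+-monoˡ-≤ (suc q) a≤p)
    aux : ∀ p q a w w' → suc (p + q) + (w + (w' + (a + suc q))) ≡ suc (w + (a + q) + (w' + suc (p + q)) + 0)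
    aux = solve-∀
    row : ∀ i → a ≤ i → i + q < suc (p + q) → c i q ≡ false
    row i a≤i b with i ≟ p
    ... | yes refl = e
    ... | no i≢p   = empty i a≤i (≤∧≢⇒< (+-cancelʳ-≤ q i p (≤-pred b)) i≢p)
  ... | true = refl , (size , d≤n , bound (wt n ⟦ c ⟧ a q d) (χ a q d p q) (wt n ⟦ r ⟧ a q d) (wt n ⟦ r ⟧ a (suc q) d)
                 (wt n ⟦ c ⟧ a (suc q) d) t (wt-remove c p q a q d e d≤n) (ind≤1 _) (drop-row r q row)
                 (subst (wt n ⟦ r ⟧ a (suc q) d ≤_) (wt-remove c p q a (suc q) d e d≤n) (m≤m+n _ _)))
    where
    r = remove c p q
    size : a + suc q ≤ suc (p + q)
    size = subst (a + suc q ≤_) (+-suc p q) (+-monoˡ-≤ (suc q) a≤p)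
    row : ∀ i → a ≤ i → i + q < suc (p + q) → r i q ≡ false
    row i a≤i b with i ≟ p
    ... | yes refl = remove-at c p q
    ... | no i≢p   = trans (remove-off c p q i q (i≢p ∘ proj₁))
                       (empty i a≤i (≤∧≢⇒< (+-cancelʳ-≤ q i p (≤-pred b)) i≢p))
    bound : ∀ w x r r' w' → suc (p + q) ≤ w + (a + q) → r + x ≡ w → x ≤ 1 → r ≤ r' → r' ≤ w' →
      suc (p + q) ≤ w' + (a + suc q)
    bound w x r r' w' h refl h' k l = lin 0 (+-mono-≤ (+-mono-≤ h h') (+-mono-≤ k l)) (aux p q a r r' x w')
      where
      aux : ∀ p q a r r' x w' → suc (p + q) + (r + x + (a + q) + 1 + (r' + w')) + 0 ≡
        w' + (a + suc q) + (suc (p + q) + x + (r + r'))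
      aux = solve-∀

  -- `l` is the number of downward triangles left in row `q`. The invariant is independence,
  -- saturation, and no hole in the row before column `p`. The continuation `next` tiles the rows
  -- above for whatever set this row leaves behind.
  sweep-row : ∀ l p q c → p + q + suc l ≡ d → a ≤ p → Ind n c → Tight n c a q d →
    (∀ i → a ≤ i → i < p → c i q ≡ false) →
    (∀ c' → Ind n c' → Tight n c' a (suc q) d → RhombTiled (RestTiles a d (suc q) a c')) →
    RhombTiled (RestTiles a d q p c)
  sweep-row zero p q c eq a≤p I t empty next =
    let d≡ = trans (+-comm 1 (p + q)) eq
        ct , t' = row-end d≡ a≤p I t empty
        ts , R , cov = next c I t'
    in ts , R , cov-row-end {ts = ts} ct d≡ a≤p cov
  sweep-row (suc l) p q c eq a≤p I t empty next = by-cases (c p q) refl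
    where
    eq' : suc p + q + suc l ≡ d
    eq' = trans (sym (+-suc (p + q) (suc l))) eq
    inside : suc (p + q) < d
    inside = subst (suc (p + q) <_) eq' (m<m+n (suc (p + q)) z<s)
    inside-n : suc (p + q) < n
    inside-n = ≤-trans inside (proj₁ (proj₂ t))
    here∈ : In a q d p q
    here∈ = a≤p , ≤-refl , <-trans (n<1+n (p + q)) inside
    moved : ∀ r → let x = nbX r p q; y = nbY r p q in
      c p q ≡ true → c x y ≡ false → Ind n (move c p q x y) → p ≤ x → q ≤ y → x + y ≡ suc (p + q) →
      (∀ i → i ≤ p → ¬ (i ≡ x × q ≡ y)) → Rest a q p x y → RhombTiled (RestTiles a d q p c)
    moved r ct cf I' p≤x q≤y xy off rest =
      let x = nbX r p q
          y = nbY r p q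
          t' = move-Tight {c} {p} {q} {x} {y} ct (<-trans (n<1+n (p + q)) inside-n) cf (subst (_< n) (sym xy) inside-n)
                 here∈ (≤-trans a≤p p≤x , q≤y , subst (_< d) (sym xy) inside) t
          ts , R , cov = sweep-row l (suc p) q (move c p q x y) eq' (m≤n⇒m≤1+n a≤p) I' t'
                           (move-empty {c} empty off) next
      in rhomb r p q ∷ ts , (r , p , q , refl) ∷ R , cov-move {c = c} {ts = ts} r ct cf rest xy inside cov
    by-cases : ∀ b → c p q ≡ b → RhombTiled (RestTiles a d q p c)
    by-cases false e =
      let ts , R , cov = sweep-row l (suc p) q c eq' (m≤n⇒m≤1+n a≤p) I t row next
      in rhombA p q ∷ ts , (A , p , q , refl) ∷ R , cov-rhombA {ts = ts} e inside cov
      where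
      row : ∀ i → a ≤ i → i < suc p → c i q ≡ false
      row i a≤i i<1+p with i ≟ p
      ... | yes refl = e
      ... | no i≢p   = empty i a≤i (≤∧≢⇒< (≤-pred i<1+p) i≢p)
    by-cases true e with exchange c p q I e inside-n
    ... | inj₁ (cf , I') = moved B e cf I' (n≤1+n p) ≤-refl refl
            (λ i i≤p i≡ → <-irrefl (proj₁ i≡) (s≤s i≤p)) (inj₁ (refl , n≤1+n p))
    ... | inj₂ (cf , I') = moved C e cf I' ≤-refl (n≤1+n q) (+-suc p q)
            (λ i i≤p i≡ → 1+n≢n (sym (proj₂ i≡))) (inj₂ (≤-refl , a≤p))

  sweep : ∀ r q c → a + q + r ≡ d → Ind n c → Tight n c a q d → RhombTiled (RestTiles a d q a c)
  -- Now `a + q ≡ d`, and every cell of `Rest` has coordinate sum at least `a + q`, so nothing is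
  -- left to tile.
  sweep zero q c eq I t = [] , [] , λ { (up i j) → inj₂ ((λ (r , b , _) → empty r b) , refl)
                                      ; (down i j) → inj₂ ((λ (r , b) → empty r (<-trans (n<1+n (i + j)) b)) , refl) }
    where
    empty : ∀ {i j} → Rest a q a i j → ¬ i + j < d
    empty r b = <⇒≱ b (subst (_≤ _) (trans (sym (+-identityʳ (a + q))) eq) (lower r))
      where
      lower : ∀ {i j} → Rest a q a i j → a + q ≤ i + j
      lower (inj₁ (refl , a≤i)) = +-monoˡ-≤ q a≤i
      lower (inj₂ (q<j , a≤i)) = +-mono-≤ a≤i (<⇒≤ q<j)
  sweep (suc r) q c eq I t = sweep-row r a q c eq ≤-refl I t (λ i a≤i i<a → contradiction a≤i (<⇒≱ i<a))
    λ c' I' t' → sweep r (suc q) c' (trans (cong (_+ r) (+-suc a q)) (trans (sym (+-suc (a + q) r)) eq)) I' t'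

Reg : ℕ → ℕ → ℕ → USet → UT → Set
Reg a b d c (up i j)   = In a b d i j × c i j ≡ false
Reg a b d c (down i j) = a ≤ i × b ≤ j × suc (i + j) < d

RestTiles-corner : ∀ {a b d c} → (∀ t → RestTiles a d b a c t → Reg a b d c t) ×
  (∀ t → Reg a b d c t → RestTiles a d b a c t)
RestTiles-corner {a} {b} {d} {c} = to , from
  where
  rest⇒ : ∀ {i j} → Rest a b a i j → a ≤ i × b ≤ j
  rest⇒ (inj₁ (refl , h)) = h , ≤-refl
  rest⇒ (inj₂ (h , h')) = h' , <⇒≤ h
  ⇒rest : ∀ {i j} → a ≤ i → b ≤ j → Rest a b a i j
  ⇒rest {i} {j} h h' with j ≟ b
  ... | yes refl = inj₁ (refl , h)
  ... | no ≢     = inj₂ (≤∧≢⇒< h' (≢ ∘ sym) , h)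
  to : ∀ t → RestTiles a d b a c t → Reg a b d c t
  to (up i j)   (r , h , e) = (proj₁ (rest⇒ r) , proj₂ (rest⇒ r) , h) , e
  to (down i j) (r , h) = proj₁ (rest⇒ r) , proj₂ (rest⇒ r) , h
  from : ∀ t → Reg a b d c t → RestTiles a d b a c t
  from (up i j)   ((h , h' , l) , e) = ⇒rest h h' , l , e
  from (down i j) (h , h' , l) = ⇒rest h h' , l

rhomb-tiling : ∀ n a b d c → Ind n c → Tight n c a b d → RhombTiled (Reg a b d c)
rhomb-tiling n a b d c I t =
  let ts , R , cov = sweep (d ∸ (a + b)) b c (m+[n∸m]≡n (proj₁ t)) I t
  in ts , R , cov-⇔ {ts = ts} (proj₁ RestTiles-corner) (proj₂ RestTiles-corner) cov

-- Making a covered triangle a hole by means of a type-2 trapezoid.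

isU : UT → UT → ℕ
isU t u = ind (eqUT t u)

isU-refl : ∀ t → isU t t ≡ 1
isU-refl t = cong ind (eqUT-refl t)

isU-≢ : ∀ {t u} → t ≢ u → isU t u ≡ 0
isU-≢ h = cong ind (eqUT-≢ _ _ h)

count-rhomb : ∀ t r i j → count t (cells (rhomb r i j)) ≡ isU t (down i j) + isU t (nb r i j)
count-rhomb t r i j = trans (cong (count t) (cells-rhomb r i j)) (cong (isU t (down i j) +_) (+-identityʳ _))

-- Takes out the rhombus that covers `up x y`. The equation between multiplicities replaces a
-- permutation of the list of tiles.
extract : ∀ x y ts → All IsRhomb ts → 1 ≤ occ (up x y) ts →
  ∃[ r ] ∃[ i ] ∃[ j ] ∃[ ts' ] (up x y ≡ nb r i j × All IsRhomb ts' ×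
    (∀ t → occ t ts ≡ isU t (down i j) + isU t (nb r i j) + occ t ts'))
extract x y (τ ∷ ts) ((r , i , j , refl) ∷ R) h with up x y ≟ᵤ nb r i j
... | yes e = r , i , j , ts , e , R , λ t → cong (_+ occ t ts) (count-rhomb t r i j)
... | no ≢ =
  let r' , i' , j' , ts' , e , R' , f =
        extract x y ts R (subst (λ v → 1 ≤ v + occ (up x y) ts) (trans (count-rhomb (up x y) r i j) (isU-≢ ≢)) h)
  in r' , i' , j' , rhomb r i j ∷ ts' , e , (r , i , j , refl) ∷ R' ,
     λ t → trans (cong (count t (cells (rhomb r i j)) +_) (f t))
       (swap (count t (cells (rhomb r i j))) (isU t (down i' j') + isU t (nb r' i' j')) (occ t ts'))
  where
  swap : ∀ u v w → u + (v + w) ≡ v + (u + w)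
  swap = solve-∀

sum₃ : ∀ u v w → u + (v + (w + 0)) ≡ u + v + w
sum₃ = solve-∀

sum₃′ : ∀ u v w → u + (v + (w + 0)) ≡ u + w + v
sum₃′ = solve-∀

-- Two different downward neighbours of one upward triangle form a type-2 trapezoid with it. The six
-- pairs of different directions give the three shapes, and equal directions would make the downward
-- triangles equal.
type2-tile : ∀ r r' i j i' j' → nb r i j ≡ nb r' i' j' → down i j ≢ down i' j' →
  ∃[ τ ] (isType2 τ ≡ true × (∀ t → count t (cells τ) ≡ isU t (nb r i j) + isU t (down i j) + isU t (down i' j')))
type2-tile A A i j i' j' refl ≢ = contradiction refl ≢
type2-tile A B i j i' j' refl ≢ = trap2A i' j , refl , λ t →
  sum₃ (isU t (up (suc i') j)) (isU t (down (suc i') j)) (isU t (down i' j))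
type2-tile A C i j i' j' refl ≢ = trap2B i j' , refl , λ t →
  sum₃ (isU t (up i (suc j'))) (isU t (down i (suc j'))) (isU t (down i j'))
type2-tile B A i j i' j' refl ≢ = trap2A i j , refl , λ t →
  sum₃′ (isU t (up (suc i) j)) (isU t (down (suc i) j)) (isU t (down i j))
type2-tile B B i j i' j' refl ≢ = contradiction refl ≢
type2-tile B C i j i' j' refl ≢ = trap2C i j' , refl , λ t →
  sum₃ (isU t (up (suc i) (suc j'))) (isU t (down i (suc j'))) (isU t (down (suc i) j'))
type2-tile C A i j i' j' refl ≢ = trap2B i j , refl , λ t →
  sum₃′ (isU t (up i (suc j))) (isU t (down i (suc j))) (isU t (down i j))
type2-tile C B i j i' j' refl ≢ = trap2C i' j , refl , λ t →
  sum₃′ (isU t (up (suc i') (suc j))) (isU t (down i' (suc j))) (isU t (down (suc i') j))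
type2-tile C C i j i' j' refl ≢ = contradiction refl ≢

rhombs-type2 : ∀ {ts} → All IsRhomb ts → numType2 ts ≡ 0
rhombs-type2 [] = refl
rhombs-type2 ((A , _ , _ , refl) ∷ R) = rhombs-type2 R
rhombs-type2 ((B , _ , _ , refl) ∷ R) = rhombs-type2 R
rhombs-type2 ((C , _ , _ , refl) ∷ R) = rhombs-type2 R

cov-covered : ∀ {P ts} → Cov P ts → ∀ t → 1 ≤ occ t ts → P t
cov-covered cov t h with cov t
... | inj₁ (p , _) = p
... | inj₂ (_ , e) = contradiction (subst (1 ≤_) e h) λ ()

cov-one : ∀ {P ts} → Cov P ts → ∀ t → P t → occ t ts ≡ 1
cov-one cov t p with cov t
... | inj₁ (_ , e)  = e
... | inj₂ (¬p , _) = contradiction p ¬p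

cov-≤1 : ∀ {P ts} → Cov P ts → ∀ t → occ t ts ≤ 1
cov-≤1 cov t with cov t
... | inj₁ (_ , e) = ≤-reflexive e
... | inj₂ (_ , e) = subst (_≤ 1) (sym e) z≤n

Tiled1 : (UT → Set) → Set
Tiled1 P = ∃[ ts ] (Cov P ts × numType2 ts ≡ 1)

nb-in : ∀ r {a b d i j} → a ≤ i → b ≤ j → suc (i + j) < d → In a b d (nbX r i j) (nbY r i j)
nb-in A {i = i} {j} h h' l = h , h' , <-trans (n<1+n (i + j)) l
nb-in B h h' l = m≤n⇒m≤1+n h , h' , l
nb-in C {d = d} {i} {j} h h' l = h , m≤n⇒m≤1+n h' , subst (_< d) (sym (+-suc i j)) l

-- The tile (D,x) of the tiling leaves D free once x becomes a hole; D is absorbed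
-- by the rhombus (D',y) of another neighbour y of D.
add-hole : ∀ {a b d c x y} → c x y ≡ true → In a b d x y →
  (∀ i j → a ≤ i → b ≤ j → suc (i + j) < d → ∃[ r ] c (nbX r i j) (nbY r i j) ≡ false) →
  RhombTiled (Reg a b d (remove c x y)) → Tiled1 (Reg a b d c)
add-hole {a} {b} {d} {c} {x} {y} ct xy∈ free (ts , R , cov)
  with extract x y ts R (≤-reflexive (sym (cov-one {ts = ts} cov (up x y) (xy∈ , remove-at c x y))))
... | r , i , j , ts₁ , x≡ , R₁ , f
  with cov-covered {ts = ts} cov (down i j) (subst (1 ≤_) (sym (f (down i j)))
         (≤-trans (≤-reflexive (sym (isU-refl (down i j)))) (≤-trans (m≤m+n _ _) (m≤m+n _ _))))
... | a≤i , b≤j , l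
  with free i j a≤i b≤j l
... | r' , cf
  with extract (nbX r' i j) (nbY r' i j) ts₁ R₁ y-covered
  where
  y≢x : nb r' i j ≢ nb r i j
  y≢x e with trans e (sym x≡)
  ... | refl = contradiction (trans (sym ct) cf) λ ()
  y-covered : 1 ≤ occ (nb r' i j) ts₁
  y-covered = ≤-reflexive (trans (sym (cov-one {ts = ts} cov (nb r' i j) (nb-in r' a≤i b≤j l , cong (_∧ _) cf)))
    (trans (f (nb r' i j)) (cong (_+ occ (nb r' i j) ts₁) (isU-≢ y≢x))))
... | r″ , i' , j' , ts₂ , y≡ , R₂ , g
  with type2-tile r' r″ i j i' j' y≡ D≢
  where
  -- Otherwise two rhombi of `ts` would cover the same downward triangle.
  D≢ : down i j ≢ down i' j'
  D≢ refl = <⇒≱ (n<1+n 1) (≤-trans (subst₂ (λ v w → 2 ≤ v + isU D (nb r i j) + (w + isU D (nb r″ i j) + occ D ts₂))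
              (sym (isU-refl D)) (sym (isU-refl D)) (two (isU D (nb r i j)) (isU D (nb r″ i j)) (occ D ts₂)))
            (subst (_≤ 1) (trans (f D) (cong (isU D D + isU D (nb r i j) +_) (g D))) (cov-≤1 {ts = ts} cov D)))
    where
    D = down i j
    two : ∀ u v w → 2 ≤ 1 + u + (1 + v + w)
    two u v w = lin (u + v + w) ≤-refl (eq u v w)
      where
      eq : ∀ u v w → 2 + 0 + (u + v + w) ≡ 1 + u + (1 + v + w) + 0
      eq = solve-∀
... | τ , τ2 , h = τ ∷ ts₂ , cov' , cong₂ (λ v w → ind v + w) τ2 (rhombs-type2 R₂)
  where
  -- The trapezoid covers what the two extracted rhombi covered, except for `up x y`.
  balance : ∀ t → occ t ts ≡ occ t (τ ∷ ts₂) + isU t (up x y)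
  balance t = begin
    occ t ts
      ≡⟨ trans (f t) (cong (isU t (down i j) + isU t (nb r i j) +_) (g t)) ⟩
    isU t (down i j) + isU t (nb r i j) + (isU t (down i' j') + isU t (nb r″ i' j') + occ t ts₂)
      ≡⟨ cong₂ (λ u v → isU t (down i j) + isU t u + (isU t (down i' j') + isU t v + occ t ts₂)) x≡ y≡ ⟨
    isU t (down i j) + isU t (up x y) + (isU t (down i' j') + isU t (nb r' i j) + occ t ts₂)
      ≡⟨ eq (isU t (down i j)) _ (isU t (down i' j')) (isU t (nb r' i j)) _ ⟩
    isU t (nb r' i j) + isU t (down i j) + isU t (down i' j') + occ t ts₂ + isU t (up x y)
      ≡⟨ cong (λ v → v + occ t ts₂ + isU t (up x y)) (h t) ⟨
    count t (cells τ) + occ t ts₂ + isU t (up x y) ∎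
    where
    open ≡-Reasoning
    eq : ∀ D x D' y o → D + x + (D' + y + o) ≡ y + D + D' + o + x
    eq = solve-∀
  weaken : ∀ t → Reg a b d c t → Reg a b d (remove c x y) t
  weaken (up i j)   (h , e) = h , cong (_∧ _) e
  weaken (down i j) h = h
  strengthen : ∀ t → t ≢ up x y → Reg a b d (remove c x y) t → Reg a b d c t
  strengthen (up i j)   t≢ (h , e) = h , trans (sym (remove-off c x y i j λ { (refl , refl) → t≢ refl })) e
  strengthen (down i j) t≢ h = h
  cov' : Cov (Reg a b d c) (τ ∷ ts₂)
  cov' t with t ≟ᵤ up x y | cov t
  ... | yes refl | inj₁ (_ , e) = inj₂ ((λ (_ , e) → contradiction (trans (sym ct) e) λ ()) ,
          +-cancelʳ-≡ (isU t t) _ 0 (trans (sym (balance t)) (trans e (sym (isU-refl t)))))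
  ... | yes refl | inj₂ (_ , e) = inj₂ ((λ (_ , e) → contradiction (trans (sym ct) e) λ ()) ,
          m+n≡0⇒m≡0 _ (trans (sym (balance t)) e))
  ... | no t≢ | inj₁ (p , e) = inj₁ (strengthen t t≢ p ,
          trans (sym (+-identityʳ _)) (trans (cong (occ t (τ ∷ ts₂) +_) (sym (isU-≢ t≢))) (trans (sym (balance t)) e)))
  ... | no t≢ | inj₂ (¬p , e) = inj₂ (¬p ∘ weaken t , m+n≡0⇒m≡0 _ (trans (sym (balance t)) e))

-- Enlarging a triangle by strips.

trap1A-unique : ∀ i j → Unique (cells (trap1A i j))
trap1A-unique i j = ((λ ()) ∷ (λ ()) ∷ []) AllPairs.∷ ((λ ()) ∷ []) AllPairs.∷ [] AllPairs.∷ AllPairs.[]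

trap1C-unique : ∀ i j → Unique (cells (trap1C i j))
trap1C-unique i j = ((λ ()) ∷ (λ ()) ∷ []) AllPairs.∷ ((λ ()) ∷ []) AllPairs.∷ [] AllPairs.∷ AllPairs.[]

cov-trap1A : ∀ {a b d p c ts} → (∀ i → c i b ≡ false) → a ≤ p → suc (suc (p + b)) ≡ d →
  Cov (Reg a (suc b) d c) ts → Cov (RestTiles a d b p c) (trap1A p b ∷ ts)
cov-trap1A {a} {b} {d} {p} {c} {ts} row a≤p refl = cov-∷ {ts = ts} (trap1A p b) (trap1A-unique p b)
  (((inj₁ (refl , ≤-refl) , ≤-refl) , λ (_ , h , _) → <-irrefl refl h) ∷
   ((inj₁ (refl , ≤-refl) , s≤s (n≤1+n _) , row p) , λ ((_ , h , _) , _) → <-irrefl refl h) ∷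
   ((inj₁ (refl , n≤1+n p) , ≤-refl , row (suc p)) , λ ((_ , h , _) , _) → <-irrefl refl h) ∷ [])
  old old'
  where
  old : ∀ t → t ∉ cells (trap1A p b) → RestTiles a d b p c t → Reg a (suc b) d c t
  old (up i j) t∉ (inj₁ (refl , p≤i) , l , e) with p ≟ i
  ... | yes refl = ⊥-elim (t∉ (there (here refl)))
  ... | no p≢i with refl ← ≤-antisym (≤∧≢⇒< p≤i p≢i) (≤-pred (+-cancelʳ-< j i (suc (suc p)) l)) =
    ⊥-elim (t∉ (there (there (here refl))))
  old (up i j) t∉ (inj₂ (b<j , a≤i) , l , e) = (a≤i , b<j , l) , e
  old (down i j) t∉ (inj₁ (refl , p≤i) , l)
    with refl ← ≤-antisym p≤i (≤-pred (+-cancelʳ-< j i (suc p) (≤-pred l))) = ⊥-elim (t∉ (here refl))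
  old (down i j) t∉ (inj₂ (b<j , a≤i) , l) = a≤i , b<j , l
  old' : ∀ t → t ∉ cells (trap1A p b) → Reg a (suc b) d c t → RestTiles a d b p c t
  old' (up i j)   t∉ ((a≤i , b<j , l) , e) = inj₂ (b<j , a≤i) , l , e
  old' (down i j) t∉ (a≤i , b<j , l) = inj₂ (b<j , a≤i) , l

-- The new bottom row has no hole and one more upward than downward triangle. A type-1 trapezoid at
-- its right end takes two upward triangles, and rhombi fill the row from there to the left.
add-row : ∀ {a b d c} → a + suc b < d → (∀ i → c i b ≡ false) → Tiled1 (Reg a (suc b) d c) → Tiled1 (Reg a b d c)
add-row {a} {b} {d} {c} size row (ts , cov , one) =
  let ts' , cov' , one' = leftwards (d ∸ (a + suc (suc b))) (≤-reflexive (eq m)) last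
  in ts' , cov-⇔ {ts = ts'} (proj₁ RestTiles-corner) (proj₂ RestTiles-corner) cov' , one'
  where
  -- With this `m`, the last downward triangle of the row is `down (a + m) b`.
  m = d ∸ (a + suc (suc b))
  m-eq : a + suc (suc b) + m ≡ d
  m-eq = m+[n∸m]≡n (subst (_≤ d) (sym (+-suc a (suc b))) size)
  eq : ∀ m → suc (suc (a + m + b)) ≡ a + suc (suc b) + m
  eq m = eq' a m b
    where
    eq' : ∀ a m b → suc (suc (a + m + b)) ≡ a + suc (suc b) + m
    eq' = solve-∀
  last : Tiled1 (RestTiles a d b (a + m) c)
  last = trap1A (a + m) b ∷ ts , cov-trap1A {ts = ts} row (m≤m+n a m) (trans (eq m) m-eq) cov , one
  leftwards : ∀ l → suc (suc (a + l + b)) ≤ a + suc (suc b) + m →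
    Tiled1 (RestTiles a d b (a + l) c) → Tiled1 (RestTiles a d b a c)
  leftwards zero    h T = subst (λ p → Tiled1 (RestTiles a d b p c)) (+-identityʳ a) T
  leftwards (suc l) h (ts , cov , one) = leftwards l (≤-trans (s≤s (s≤s (+-monoˡ-≤ b (+-monoʳ-≤ a (n≤1+n l))))) h)
    (rhombA (a + l) b ∷ ts ,
     cov-rhombA {ts = ts} (row (a + l))
       (subst (suc (a + l + b) <_) m-eq (≤-trans (s≤s (s≤s (+-monoˡ-≤ b (+-monoʳ-≤ a (n≤1+n l))))) h))
       (subst (λ p → Cov (RestTiles a d b p c) ts) (+-suc a l) cov) ,
     one)

-- The reflection exchanging the two lattice directions, by which columns are reduced to rows.
swapUT : UT → UT
swapUT (up i j)   = up j i
swapUT (down i j) = down j i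

swapTile : Tile → Tile
swapTile (rhombA i j) = rhombA j i
swapTile (rhombB i j) = rhombC j i
swapTile (rhombC i j) = rhombB j i
swapTile (trap1A i j) = trap1B j i
swapTile (trap1B i j) = trap1A j i
swapTile (trap1C i j) = trap1C j i
swapTile (trap2A i j) = trap2B j i
swapTile (trap2B i j) = trap2A j i
swapTile (trap2C i j) = trap2C j i

isU-swap : ∀ t u → isU (swapUT t) (swapUT u) ≡ isU t u
isU-swap (up i j)   (up k l)   = cong ind (∧-comm (j ≡ᵇ l) (i ≡ᵇ k))
isU-swap (up i j)   (down k l) = refl
isU-swap (down i j) (up k l)   = refl
isU-swap (down i j) (down k l) = cong ind (∧-comm (j ≡ᵇ l) (i ≡ᵇ k))

count-map-swap : ∀ t us → count (swapUT t) (map swapUT us) ≡ count t us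
count-map-swap t []       = refl
count-map-swap t (u ∷ us) = cong₂ _+_ (isU-swap t u) (count-map-swap t us)

count-swap : ∀ t τ → count (swapUT t) (cells (swapTile τ)) ≡ count t (cells τ)
count-swap t τ@(rhombA i j) = count-map-swap t (cells τ)
count-swap t τ@(rhombB i j) = count-map-swap t (cells τ)
count-swap t τ@(rhombC i j) = count-map-swap t (cells τ)
count-swap t τ@(trap1A i j) = count-map-swap t (cells τ)
count-swap t τ@(trap1B i j) = count-map-swap t (cells τ)
count-swap t τ@(trap2A i j) = count-map-swap t (cells τ)
count-swap t τ@(trap2B i j) = count-map-swap t (cells τ)
-- The shapes `trap1C` and `trap2C` are symmetric under the reflection, but their last two cells
-- come out in the opposite order.
count-swap t τ@(trap1C i j) = trans
  (comm (isU (swapUT t) (down j i)) (isU (swapUT t) (up (suc j) i)) (isU (swapUT t) (up j (suc i))))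
  (count-map-swap t (cells τ))
  where
  comm : ∀ u v w → u + (v + (w + 0)) ≡ u + (w + (v + 0))
  comm = solve-∀
count-swap t τ@(trap2C i j) = trans
  (comm (isU (swapUT t) (up (suc j) (suc i))) (isU (swapUT t) (down j (suc i))) (isU (swapUT t) (down (suc j) i)))
  (count-map-swap t (cells τ))
  where
  comm : ∀ u v w → u + (v + (w + 0)) ≡ u + (w + (v + 0))
  comm = solve-∀

occ-swap : ∀ t ts → occ (swapUT t) (map swapTile ts) ≡ occ t ts
occ-swap t []       = refl
occ-swap t (τ ∷ ts) = cong₂ _+_ (count-swap t τ) (occ-swap t ts)

type2-swap : ∀ ts → numType2 (map swapTile ts) ≡ numType2 ts
type2-swap []       = refl
type2-swap (τ ∷ ts) = cong₂ _+_ (cong ind (same τ)) (type2-swap ts)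
  where
  same : ∀ τ → isType2 (swapTile τ) ≡ isType2 τ
  same (rhombA _ _) = refl
  same (rhombB _ _) = refl
  same (rhombC _ _) = refl
  same (trap1A _ _) = refl
  same (trap1B _ _) = refl
  same (trap1C _ _) = refl
  same (trap2A _ _) = refl
  same (trap2B _ _) = refl
  same (trap2C _ _) = refl

swap-tiled : ∀ {a b d} c → Tiled1 (Reg a b d c) → Tiled1 (Reg b a d (λ i j → c j i))
swap-tiled {a} {b} {d} c (ts , cov , one) = map swapTile ts , cov' , trans (type2-swap ts) one
  where
  comm : ∀ i j {d} → i + j < d → j + i < d
  comm i j {d} = subst (_< d) (+-comm i j)
  comm' : ∀ i j {d} → suc (i + j) < d → suc (j + i) < d
  comm' i j {d} = subst (λ m → suc m < d) (+-comm i j)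
  cov' : Cov (Reg b a d (λ i j → c j i)) (map swapTile ts)
  cov' (up i j) with cov (up j i)
  ... | inj₁ (((h , h' , l) , e) , o) = inj₁ (((h' , h , comm j i l) , e) , trans (occ-swap (up j i) ts) o)
  ... | inj₂ (¬p , o) = inj₂ ((λ ((h , h' , l) , e) → ¬p ((h' , h , comm i j l) , e)) , trans (occ-swap (up j i) ts) o)
  cov' (down i j) with cov (down j i)
  ... | inj₁ ((h , h' , l) , o) = inj₁ ((h' , h , comm' j i l) , trans (occ-swap (down j i) ts) o)
  ... | inj₂ (¬p , o) = inj₂ ((λ (h , h' , l) → ¬p (h' , h , comm' i j l)) , trans (occ-swap (down j i) ts) o)

add-column : ∀ {a b d c} → suc a + b < d → (∀ j → c a j ≡ false) → Tiled1 (Reg (suc a) b d c) → Tiled1 (Reg a b d c)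
add-column {a} {b} {d} {c} size col T = swap-tiled (λ i j → c j i)
  (add-row (subst (_< d) (+-comm (suc a) b) size) col (swap-tiled c T))

-- The triangle with bound s together with the part i ≥ p of the next diagonal.
Diag : ℕ → ℕ → ℕ → ℕ → ℕ → ℕ → ℕ → Set
Diag a b s p m i j = (m ≡ s × p ≤ i × b ≤ j) ⊎ (m < s × a ≤ i × b ≤ j)

DiagTiles : ℕ → ℕ → ℕ → ℕ → USet → UT → Set
DiagTiles a b s p c (up i j)   = Diag a b s p (i + j) i j × c i j ≡ false
DiagTiles a b s p c (down i j) = Diag a b s p (suc (i + j)) i j

module _ {a b s : ℕ} {c : USet} (diag : ∀ i j → i + j ≡ s → c i j ≡ false) where

  cov-trap1C : ∀ {p ts} → suc (p + b) ≡ s → Cov (Reg a b s c) ts → Cov (DiagTiles a b s p c) (trap1C p b ∷ ts)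
  cov-trap1C {p} {ts} refl = cov-∷ {ts = ts} (trap1C p b) (trap1C-unique p b)
    ((inj₁ (refl , ≤-refl , ≤-refl) , λ (_ , _ , l) → <-irrefl refl l) ∷
     ((inj₁ (refl , n≤1+n p , ≤-refl) , diag (suc p) b refl) , λ ((_ , _ , l) , _) → <-irrefl refl l) ∷
     ((inj₁ (+-suc p b , ≤-refl , n≤1+n b) , diag p (suc b) (+-suc p b)) ,
       λ ((_ , _ , l) , _) → <-irrefl (+-suc p b) l) ∷ [])
    old old'
    where
    old : ∀ t → t ∉ cells (trap1C p b) → DiagTiles a b s p c t → Reg a b s c t
    old (up i j) t∉ (inj₁ (m , p≤i , b≤j) , e) with p ≟ i
    ... | yes refl with refl ← +-cancelˡ-≡ p j (suc b) (trans m (sym (+-suc p b))) = ⊥-elim (t∉ (there (there (here refl))))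
    ... | no p≢i with refl ← ≤-antisym (+-cancelˡ-≤ (suc p) j b
                       (≤-trans (+-monoˡ-≤ j (≤∧≢⇒< p≤i p≢i)) (≤-reflexive m))) b≤j
                 with refl ← +-cancelʳ-≡ j i (suc p) m = ⊥-elim (t∉ (there (here refl)))
    old (up i j) t∉ (inj₂ (l , h , h') , e) = (h , h' , l) , e
    old (down i j) t∉ (inj₁ (m , p≤i , b≤j))
      with refl ← ≤-antisym (+-cancelˡ-≤ p j b (≤-trans (+-monoˡ-≤ j p≤i) (≤-reflexive (suc-injective m)))) b≤j
      with refl ← +-cancelʳ-≡ j i p (suc-injective m) = ⊥-elim (t∉ (here refl))
    old (down i j) t∉ (inj₂ (l , h , h')) = h , h' , l
    old' : ∀ t → t ∉ cells (trap1C p b) → Reg a b s c t → DiagTiles a b s p c t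
    old' (up i j)   t∉ ((h , h' , l) , e) = inj₂ (l , h , h') , e
    old' (down i j) t∉ (h , h' , l) = inj₂ (l , h , h')

  cov-rhombC : ∀ {p q ts} → suc (p + q) ≡ s → b ≤ q →
    Cov (DiagTiles a b s (suc p) c) ts → Cov (DiagTiles a b s p c) (rhombC p q ∷ ts)
  cov-rhombC {p} {q} {ts} refl b≤q = cov-∷ {ts = ts} (rhombC p q) rhomb-unique
    ((inj₁ (refl , ≤-refl , b≤q) , λ { (inj₁ (_ , h , _)) → <-irrefl refl h ; (inj₂ (l , _)) → <-irrefl refl l }) ∷
     ((inj₁ (+-suc p q , ≤-refl , m≤n⇒m≤1+n b≤q) , diag p (suc q) (+-suc p q)) ,
       λ { (inj₁ (_ , h , _) , _) → <-irrefl refl h ; (inj₂ (l , _) , _) → <-irrefl (+-suc p q) l }) ∷ [])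
    old old'
    where
    old : ∀ t → t ∉ cells (rhombC p q) → DiagTiles a b s p c t → DiagTiles a b s (suc p) c t
    old (up i j) t∉ (inj₁ (m , p≤i , b≤j) , e) with p ≟ i
    ... | yes refl with refl ← +-cancelˡ-≡ p j (suc q) (trans m (sym (+-suc p q))) = ⊥-elim (t∉ (there (here refl)))
    ... | no p≢i = inj₁ (m , ≤∧≢⇒< p≤i p≢i , b≤j) , e
    old (up i j) t∉ (inj₂ z , e) = inj₂ z , e
    old (down i j) t∉ (inj₁ (m , p≤i , b≤j)) with p ≟ i
    ... | yes refl with refl ← +-cancelˡ-≡ p j q (suc-injective m) = ⊥-elim (t∉ (here refl))
    ... | no p≢i = inj₁ (m , ≤∧≢⇒< p≤i p≢i , b≤j)
    old (down i j) t∉ (inj₂ z) = inj₂ z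
    old' : ∀ t → t ∉ cells (rhombC p q) → DiagTiles a b s (suc p) c t → DiagTiles a b s p c t
    old' (up i j)   t∉ (inj₁ (m , h , h') , e) = inj₁ (m , <⇒≤ h , h') , e
    old' (up i j)   t∉ (inj₂ z , e) = inj₂ z , e
    old' (down i j) t∉ (inj₁ (m , h , h')) = inj₁ (m , <⇒≤ h , h')
    old' (down i j) t∉ (inj₂ z) = inj₂ z

  -- As for a row, with the strip along the slanted side: the type-1 trapezoid lies at its lower end
  -- in row `b`, and the rhombi climb from there to the left side.
  add-diagonal : a + b < s → Tiled1 (Reg a b s c) → Tiled1 (Reg a b (suc s) c)
  add-diagonal size (ts , cov , one) =
    let ts' , cov' , one' = leftwards m b (trans (eq m b) m-eq) ≤-refl last
    in ts' , cov-⇔ {ts = ts'} to from cov' , one'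
    where
    m = s ∸ suc (a + b)
    m-eq : suc (a + b) + m ≡ s
    m-eq = m+[n∸m]≡n size
    eq : ∀ m b → suc (a + m + b) ≡ suc (a + b) + m
    eq m b = eq' a m b
      where
      eq' : ∀ a m b → suc (a + m + b) ≡ suc (a + b) + m
      eq' = solve-∀
    last : Tiled1 (DiagTiles a b s (a + m) c)
    last = trap1C (a + m) b ∷ ts , cov-trap1C {ts = ts} (trans (eq m b) m-eq) cov , one
    leftwards : ∀ l q → suc (a + l + q) ≡ s → b ≤ q → Tiled1 (DiagTiles a b s (a + l) c) → Tiled1 (DiagTiles a b s a c)
    leftwards zero    q h b≤q T = subst (λ p → Tiled1 (DiagTiles a b s p c)) (+-identityʳ a) T
    leftwards (suc l) q h b≤q (ts , cov , one) = leftwards l (suc q) h' (m≤n⇒m≤1+n b≤q)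
      (rhombC (a + l) (suc q) ∷ ts ,
       cov-rhombC {ts = ts} h' (m≤n⇒m≤1+n b≤q) (subst (λ p → Cov (DiagTiles a b s p c) ts) (+-suc a l) cov) ,
       one)
      where
      h' : suc (a + l + suc q) ≡ s
      h' = trans (eq' a l q) h
        where
        eq' : ∀ a l q → suc (a + l + suc q) ≡ suc (a + suc l + q)
        eq' = solve-∀
    bound : ∀ {i j m} → Diag a b s a m i j → a ≤ i × b ≤ j × m < suc s
    bound (inj₁ (refl , h , h')) = h , h' , ≤-refl
    bound (inj₂ (l , h , h')) = h , h' , m<n⇒m<1+n l
    unbound : ∀ {i j m} → a ≤ i → b ≤ j → m < suc s → Diag a b s a m i j
    unbound {m = m} h h' l with m ≟ s
    ... | yes e = inj₁ (e , h , h')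
    ... | no m≢s = inj₂ (≤∧≢⇒< (≤-pred l) m≢s , h , h')
    to : ∀ t → DiagTiles a b s a c t → Reg a b (suc s) c t
    to (up i j)   (z , e) = bound z , e
    to (down i j) z = bound z
    from : ∀ t → Reg a b (suc s) c t → DiagTiles a b s a c t
    from (up i j)   ((h , h' , l) , e) = unbound h h' l , e
    from (down i j) (h , h' , l) = unbound h h' l

Supported : USet → ℕ → ℕ → ℕ → Set
Supported c a b d = ∀ i j → c i j ≡ true → In a b d i j

outside : ∀ {c a b d} → Supported c a b d → ∀ i j → ¬ In a b d i j → c i j ≡ false
outside {c} S i j h with c i j in e
... | true  = contradiction (S i j e) h
... | false = refl

add-rows : ∀ b {a d c} → a + b < d → Supported c a b d → Tiled1 (Reg a b d c) → Tiled1 (Reg a 0 d c)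
add-rows zero    size S T = T
add-rows (suc b) {a} {d} size S T = add-rows b (≤-<-trans (+-monoʳ-≤ a (n≤1+n b)) size)
  (λ i j h → let x , y , z = S i j h in x , <⇒≤ y , z)
  (add-row size (λ i → outside S i b λ (_ , h , _) → <-irrefl refl h) T)

add-columns : ∀ a {b d c} → a + b < d → Supported c a b d → Tiled1 (Reg a b d c) → Tiled1 (Reg 0 b d c)
add-columns zero    size S T = T
add-columns (suc a) {b} {d} size S T = add-columns a (<-trans (n<1+n (a + b)) size)
  (λ i j h → let x , y , z = S i j h in <⇒≤ x , y , z)
  (add-column size (λ j → outside S a j λ (h , _) → <-irrefl refl h) T)

add-diagonals : ∀ m {a b d c} → a + b < d → Supported c a b d → Tiled1 (Reg a b d c) → Tiled1 (Reg a b (m + d) c)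
add-diagonals zero    size S T = T
add-diagonals (suc m) {a} {b} {d} {c} size S T = subst (λ e → Tiled1 (Reg a b e c)) (+-suc m d)
  (add-diagonals m (m<n⇒m<1+n size) (λ i j h → let x , y , z = S i j h in x , y , m<n⇒m<1+n z)
    (add-diagonal (λ i j e → outside S i j λ (_ , _ , l) → <-irrefl e l) size T))

-- Diagonals are added first, then columns, then rows. `Supported` keeps every strip free of holes,
-- and `a + b < d` gives each strip the two upward triangles that its trapezoid needs.
fill : ∀ {n a b d c} → a + b < d → d ≤ n → Supported c a b d → Tiled1 (Reg a b d c) → Tiled1 (Reg 0 0 n c)
fill {n} {a} {b} {d} {c} size d≤n S T =
  add-rows b (≤-<-trans (m≤n+m b a) size') (λ i j h → let _ , y , z = S' i j h in z≤n , y , z)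
    (add-columns a size' S' (subst (λ e → Tiled1 (Reg a b e c)) (m∸n+n≡m d≤n) (add-diagonals (n ∸ d) size S T)))
  where
  size' : a + b < n
  size' = <-≤-trans size d≤n
  S' : Supported c a b n
  S' i j h = let x , y , z = S i j h in x , y , <-≤-trans z d≤n

-- Tilings of T_n and the lower bound on type-2 trapezoids.

occ-∈ : ∀ {τ ts u} → τ ∈ ts → u ∈ cells τ → 1 ≤ occ u ts
occ-∈ {τ} {u = u} (here refl) h = ≤-trans (count-∈ u (cells τ) h) (m≤m+n _ _)
occ-∈ (there τ∈) h = ≤-trans (occ-∈ τ∈ h) (m≤n+m _ _)

cov⇒tiling : ∀ {n c ts} → Cov (Reg 0 0 n c) ts → Tiling n c ts
cov⇒tiling {n} {c} {ts} cov =
  All.tabulate (λ {τ} τ∈ → All.tabulate λ {u} u∈ → to u (cov-covered {ts = ts} cov u (occ-∈ τ∈ u∈))) ,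
  λ t r → cov-one {ts = ts} cov t (from t r)
  where
  to : ∀ t → Reg 0 0 n c t → InRegion n c t
  to (up i j)   ((_ , _ , l) , e) = l , e
  to (down i j) (_ , _ , l) = l
  from : ∀ t → InRegion n c t → Reg 0 0 n c t
  from (up i j)   (l , e) = (z≤n , z≤n , l) , e
  from (down i j) l = z≤n , z≤n , l

one : ℕ → ℕ → ℕ
one _ _ = 1

sum-1 : ∀ k → sumBelow k (λ _ → 1) ≡ k
sum-1 zero    = refl
sum-1 (suc k) = trans (cong (_+ 1) (sum-1 k)) (+-comm k 1)

-- The downward triangles of the triangle with bound `suc e` are the `down i j` with `(i,j)` below
-- the bound `e`. So its upward triangles exceed its downward ones in number by exactly its size
-- `suc e − (a + b)`.
wt-one-suc : ∀ n a b e → a + b ≤ e → suc e ≤ n → wt n one a b (suc e) + (a + b) ≡ wt n one a b e + suc e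
wt-one-suc n a b e size e<n = begin
  wt n one a b (suc e) + (a + b)
    ≡⟨ cong (λ d → wt n one a b d + (a + b)) (trans (+-suc (a + b) k) (cong suc k-eq)) ⟨
  wt n one a b (a + b + suc k) + (a + b)
    ≡⟨ cong (_+ (a + b)) (wtsum n one a b (suc k)
         (subst (_≤ n) (sym (trans (+-suc (a + b) k) (cong suc k-eq))) e<n)) ⟨
  tri (suc k) + (a + b)
    -- The first column has `k + 1` upward triangles, and the other columns form a triangle of size
    -- `k`.
    ≡⟨ cong (_+ (a + b)) (trans (sum-front k _) (cong (_+ tri k) (sum-1 (suc k)))) ⟩
  suc k + tri k + (a + b)
    ≡⟨ eq k (tri k) (a + b) ⟩
  tri k + suc (a + b + k)
    ≡⟨ cong₂ (λ v d → v + suc d) (wtsum n one a b k (≤-trans (≤-reflexive k-eq) (<⇒≤ e<n))) k-eq ⟩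
  wt n one a b (a + b + k) + suc e
    ≡⟨ cong (λ d → wt n one a b d + suc e) k-eq ⟩
  wt n one a b e + suc e ∎
  where
  open ≡-Reasoning
  k = e ∸ (a + b)
  k-eq : a + b + k ≡ e
  k-eq = m+[n∸m]≡n size
  tri : ℕ → ℕ
  tri k = sumBelow k λ i → sumBelow (k ∸ i) λ j → 1
  eq : ∀ k t s → suc k + t + s ≡ t + suc (s + k)
  eq = solve-∀

InTriangle : ℕ → UT → Set
InTriangle n (up i j)   = i + j < n
InTriangle n (down i j) = suc (suc (i + j)) ≤ n

module _ (n a b e : ℕ) where

  -- Both indicators refer to the one triangle with bound `suc e`; for a downward triangle, lying in
  -- it means `i + j < e`.
  downs ups : UT → ℕ
  downs (up i j)   = 0
  downs (down i j) = χ a b e i j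
  ups (up i j)   = χ a b (suc e) i j
  ups (down i j) = 0

  wt-zero : ∀ d → wt n (λ _ _ → 0) a b d ≡ 0
  wt-zero d = wt-0 n (λ _ _ → 0) a b d λ _ _ _ → refl

  wt-isU-down : ∀ u → InTriangle n u → wt n (λ i j → isU (down i j) u) a b e ≡ downs u
  wt-isU-down (up x y)   h = wt-zero e
  wt-isU-down (down x y) h = wt-δ n x y a b e (≤-trans (s≤s (m≤m+n x y)) (<⇒≤ h)) (≤-trans (s≤s (m≤n+m y x)) (<⇒≤ h))

  wt-isU-up : ∀ u → InTriangle n u → wt n (λ i j → isU (up i j) u) a b (suc e) ≡ ups u
  wt-isU-up (down x y) h = wt-zero (suc e)
  wt-isU-up (up x y)   h = wt-δ n x y a b (suc e) (≤-trans (s≤s (m≤m+n x y)) h) (≤-trans (s≤s (m≤n+m y x)) h)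

  wt-count-down : ∀ us → All (InTriangle n) us → wt n (λ i j → count (down i j) us) a b e ≡ sum (map downs us)
  wt-count-down []       []      = wt-zero e
  wt-count-down (u ∷ us) (h ∷ H) = trans (wt-+ n (λ i j → isU (down i j) u) (λ i j → count (down i j) us) a b e)
    (cong₂ _+_ (wt-isU-down u h) (wt-count-down us H))

  wt-count-up : ∀ us → All (InTriangle n) us → wt n (λ i j → count (up i j) us) a b (suc e) ≡ sum (map ups us)
  wt-count-up []       []      = wt-zero (suc e)
  wt-count-up (u ∷ us) (h ∷ H) = trans (wt-+ n (λ i j → isU (up i j) u) (λ i j → count (up i j) us) a b (suc e))
    (cong₂ _+_ (wt-isU-up u h) (wt-count-up us H))

  down≤nb : ∀ r i j → downs (down i j) ≤ ups (nb r i j)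
  down≤nb r i j = χ-mono {a} {b} {e} {i} {j} {a} {b} {suc e} λ (h , h' , l) → nb-in r h h' (s≤s l)

  -- A downward cell inside the triangle has all its upward neighbours inside (`down≤nb`), so an
  -- upward cell of the tile offsets it. Only type 2 has a second downward cell, which counts for at
  -- most one.
  tile-excess : ∀ τ → sum (map downs (cells τ)) ≤ sum (map ups (cells τ)) + ind (isType2 τ)
  tile-excess τ = by-shape τ
    where
    one-down : ∀ {x y} → x ≤ y → ∀ z → x + 0 ≤ y + z + 0
    one-down {x} {y} h z = lin z h (eq x y z)
      where
      eq : ∀ x y z → x + 0 + y + z ≡ y + z + 0 + x
      eq = solve-∀
    two-downs : ∀ {x x' y} → x ≤ y → x' ≤ 1 → x + (x' + 0) ≤ y + 0 + 1
    two-downs {x} {x'} {y} h h' = lin 0 (+-mono-≤ h h') (eq x x' y)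
      where
      eq : ∀ x x' y → x + (x' + 0) + (y + 1) + 0 ≡ y + 0 + 1 + (x + x')
      eq = solve-∀
    by-shape : ∀ τ → sum (map downs (cells τ)) ≤ sum (map ups (cells τ)) + ind (isType2 τ)
    by-shape (rhombA i j) = one-down (down≤nb A i j) 0
    by-shape (rhombB i j) = one-down (down≤nb B i j) 0
    by-shape (rhombC i j) = one-down (down≤nb C i j) 0
    by-shape (trap1A i j) = one-down (down≤nb A i j) _
    by-shape (trap1B i j) = one-down (down≤nb A i j) _
    by-shape (trap1C i j) = one-down (down≤nb B i j) _
    by-shape (trap2A i j) = two-downs (down≤nb A (suc i) j) (ind≤1 _)
    by-shape (trap2B i j) = two-downs (down≤nb A i (suc j)) (ind≤1 _)
    by-shape (trap2C i j) = two-downs (down≤nb B i (suc j)) (ind≤1 _)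

  tiles-excess : ∀ ts → All (λ τ → All (InTriangle n) (cells τ)) ts →
    wt n (λ i j → occ (down i j) ts) a b e ≤ wt n (λ i j → occ (up i j) ts) a b (suc e) + numType2 ts
  tiles-excess []       []      = subst (_≤ wt n (λ _ _ → 0) a b (suc e) + 0) (sym (wt-zero e)) z≤n
  tiles-excess (τ ∷ ts) (h ∷ H) = begin
    wt n (λ i j → occ (down i j) (τ ∷ ts)) a b e
      ≡⟨ wt-+ n (λ i j → count (down i j) (cells τ)) (λ i j → occ (down i j) ts) a b e ⟩
    wt n (λ i j → count (down i j) (cells τ)) a b e + wt n (λ i j → occ (down i j) ts) a b e
      ≤⟨ +-mono-≤ (≤-trans (≤-reflexive (wt-count-down (cells τ) h)) (tile-excess τ)) (tiles-excess ts H) ⟩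
    sum (map ups (cells τ)) + ind (isType2 τ) + (wt n (λ i j → occ (up i j) ts) a b (suc e) + numType2 ts)
      ≡⟨ eq (sum (map ups (cells τ))) (ind (isType2 τ)) _ (numType2 ts) ⟩
    sum (map ups (cells τ)) + wt n (λ i j → occ (up i j) ts) a b (suc e) + numType2 (τ ∷ ts)
      ≡⟨ cong (λ v → v + wt n (λ i j → occ (up i j) ts) a b (suc e) + numType2 (τ ∷ ts)) (wt-count-up (cells τ) h) ⟨
    wt n (λ i j → count (up i j) (cells τ)) a b (suc e) + wt n (λ i j → occ (up i j) ts) a b (suc e) + numType2 (τ ∷ ts)
      ≡⟨ cong (_+ numType2 (τ ∷ ts))
           (wt-+ n (λ i j → count (up i j) (cells τ)) (λ i j → occ (up i j) ts) a b (suc e)) ⟨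
    wt n (λ i j → occ (up i j) (τ ∷ ts)) a b (suc e) + numType2 (τ ∷ ts) ∎
    where
    open ≤-Reasoning
    eq : ∀ u t o m → u + t + (o + m) ≡ u + o + (t + m)
    eq = solve-∀

  -- The tiles inside a triangle of size k have to cover its downward triangles,
  -- which number k fewer than its upward triangles, and a tile covers more downward
  -- than upward triangles of it only if it has type 2.
  type2-bound : ∀ c ts → a + b ≤ e → suc e ≤ n → Tiling n c ts →
    wt n ⟦ c ⟧ a b (suc e) + (a + b) ≤ suc e + numType2 ts
  type2-bound c ts size e<n (inside , once) =
    bound (wt n (λ i j → occ (down i j) ts) a b e) (wt n (λ i j → occ (up i j) ts) a b (suc e))
      (wt n ⟦ c ⟧ a b (suc e)) (wt n one a b e) (wt n one a b (suc e)) (numType2 ts)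
      (wt-cong-in n a b e λ i j (_ , _ , l) → once (down i j) (≤-trans (s≤s l) e<n))
      (trans (sym (wt-+ n (λ i j → occ (up i j) ts) ⟦ c ⟧ a b (suc e)))
        (wt-cong-in n a b (suc e) λ i j (_ , _ , l) → up-or-hole i j (≤-trans l e<n)))
      (wt-one-suc n a b e size e<n)
      (tiles-excess ts (All.map (All.map (λ {t} → in-triangle t)) inside))
    where
    in-triangle : ∀ t → InRegion n c t → InTriangle n t
    in-triangle (up i j)   = proj₁
    in-triangle (down i j) = id
    uncovered : ∀ t us → All (λ τ → All (InRegion n c) (cells τ)) us → ¬ InRegion n c t → occ t us ≡ 0
    uncovered t []       []      ¬r = refl
    uncovered t (τ ∷ us) (h ∷ H) ¬r = cong₂ _+_ (count-∉ t (cells τ) (¬r ∘ All.lookup h)) (uncovered t us H ¬r)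
    up-or-hole : ∀ i j → i + j < n → occ (up i j) ts + ⟦ c ⟧ i j ≡ 1
    up-or-hole i j l with c i j in eq
    ... | false = trans (+-identityʳ _) (once (up i j) (l , eq))
    ... | true  = cong (_+ 1) (uncovered (up i j) ts inside λ (_ , eq') → contradiction (trans (sym eq) eq') λ ())
    bound : ∀ D U w o o' m → D ≡ o → U + w ≡ o' → o' + (a + b) ≡ o + suc e → D ≤ U + m → w + (a + b) ≤ suc e + m
    bound D U w .D .(U + w) m refl refl h h' =
      lin 0 (+-mono-≤ (≤-reflexive h) h') (eq D U w a b e m)
      where
      eq : ∀ D U w a b e m → w + (a + b) + (D + suc e + (U + m)) + 0 ≡ suc e + m + (U + w + (a + b) + D)
      eq = solve-∀

-- From a circuit to its hull and a tiling.

sum-pos : ∀ k f → 1 ≤ sumBelow k f → ∃[ i ] 1 ≤ f i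
sum-pos (suc k) f h with f k in e
... | suc m = k , subst (1 ≤_) (sym e) (s≤s z≤n)
... | zero  = sum-pos k f (subst (1 ≤_) (+-identityʳ _) h)

wt-pos : ∀ n s a b d → 1 ≤ wt n ⟦ s ⟧ a b d → ∃[ i ] ∃[ j ] s i j ≡ true
wt-pos n s a b d h with sum-pos n _ h
... | i , h' with sum-pos n _ h'
...   | j , h″ with s i j in e
...     | true  = i , j , e
...     | false = contradiction (subst (1 ≤_) (*-zeroʳ (χ a b d i j)) h″) λ ()

Independent⇒Ind : ∀ {n s} → Independent n s → Ind n s
Independent⇒Ind {n} {s} I a b d size d≤n with d ∸ (a + b) in e
-- `LatTri` excludes size 0, but an empty triangle has weight 0.
... | zero = subst (λ w → w + (a + b) ≤ d) (sym (wt-0 n ⟦ s ⟧ a b d λ i j (h , h' , l) →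
               ⊥-elim (<⇒≱ l (≤-trans (m∸n≡0⇒m≤n e) (+-mono-≤ h h'))))) size
... | suc k = subst (λ d → wt n ⟦ s ⟧ a b d + (a + b) ≤ d) d-eq
    (subst (λ w → w + (a + b) ≤ a + b + suc k) (cnt≡wt n s a b (suc k) d'≤n)
      (subst (cnt s a b (suc k) + (a + b) ≤_) (+-comm (suc k) (a + b))
        (+-monoˡ-≤ (a + b) (I a b (suc k) (s≤s z≤n , d'≤n)))))
  where
  d-eq : a + b + suc k ≡ d
  d-eq = trans (cong (a + b +_) (sym e)) (m+[n∸m]≡n size)
  d'≤n : a + b + suc k ≤ n
  d'≤n = subst (_≤ n) (sym d-eq) d≤n

Ind⇒Independent : ∀ {n s} → Ind n s → Independent n s
Ind⇒Independent {n} {s} I a b k (_ , d≤n) = +-cancelʳ-≤ (a + b) _ k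
  (subst₂ _≤_ (cong (_+ (a + b)) (sym (cnt≡wt n s a b k d≤n))) (+-comm (a + b) k) (I a b (a + b + k) (m≤m+n (a + b) k) d≤n))

module _ {n : ℕ} {c : USet} (c⊆T : InTn n c) (4≤c : 4 ≤ card n c) where

  supported-card : ∀ {a b d} → Supported c a b d → card n c ≤ wt n ⟦ c ⟧ a b d
  supported-card {a} {b} {d} S = subst (_≤ wt n ⟦ c ⟧ a b d) (sym (cnt≡wt n c 0 0 n ≤-refl))
    (wt-⊆ n ⟦ c ⟧ 0 0 n a b d pointwise)
    where
    pointwise : ∀ i j → In 0 0 n i j → In a b d i j ⊎ ⟦ c ⟧ i j ≡ 0
    pointwise i j _ with c i j in e
    ... | true  = inj₁ (S i j e)
    ... | false = inj₂ refl

  element : ∃[ x ] ∃[ y ] c x y ≡ true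
  element = wt-pos n c 0 0 n (subst (1 ≤_) (cnt≡wt n c 0 0 n ≤-refl) (≤-trans (s≤s z≤n) 4≤c))

  module _ (circuit : Circuit n c) where

    remove-independent : ∀ {x y} → c x y ≡ true → Ind n (remove c x y)
    remove-independent {x} {y} h = Independent⇒Ind (proj₂ circuit (remove c x y) (sub , x , y , h , remove-at c x y))
      where
      sub : remove c x y ⊆ᵤ c
      sub i j e with c i j
      ... | true  = refl
      ... | false = e

    -- Removing one element makes the set independent and lowers any weight by at most one.
    excess≤1 : ∀ a b d → a + b ≤ d → d ≤ n → wt n ⟦ c ⟧ a b d + (a + b) ≤ suc d
    excess≤1 a b d size d≤n = let x , y , h = element in
      bound (wt n ⟦ remove c x y ⟧ a b d) (χ a b d x y) _ (wt-remove c x y a b d h (c⊆T x y h))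
        (ind≤1 _) (remove-independent h a b d size d≤n)
      where
      bound : ∀ r z w → r + z ≡ w → z ≤ 1 → r + (a + b) ≤ d → w + (a + b) ≤ suc d
      bound r z w refl h h' = lin 0 (+-mono-≤ h h') (eq r z a b d)
        where
        eq : ∀ r z a b d → r + z + (a + b) + (1 + d) + 0 ≡ suc d + (z + (r + (a + b)))
        eq = solve-∀

    -- An element outside an over-saturated triangle could be removed with the triangle still
    -- over-saturated, although the smaller set is independent.
    over-supported : ∀ {a b d} → Over n c a b d → Supported c a b d
    over-supported {a} {b} {d} (size , d≤n , over) i j h with in? a b d i j
    ... | yes p = p
    ... | no ¬p = ⊥-elim (<⇒≱ over (subst (λ w → w + (a + b) ≤ d)
            (trans (sym (+-identityʳ _)) (trans (cong (wt n ⟦ remove c i j ⟧ a b d +_) (sym (χ-out ¬p)))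
              (wt-remove c i j a b d h (c⊆T i j h))))
            (remove-independent h a b d size d≤n)))

    over-hull : ∃[ a ] ∃[ b ] ∃[ d ] Over n c a b d
    over-hull with Ind⊎Over n c
    ... | inj₁ I = contradiction (Ind⇒Independent I) (proj₁ circuit)
    ... | inj₂ o = o

    -- A triangle containing `c` weighs at least as much as the over-saturated one, yet by
    -- `excess≤1` its weight exceeds its size by at most one. Hence it is at least as large.
    over-minimal : ∀ {a b d a' b' d'} → Over n c a b d → Supported c a' b' d' → a' + b' ≤ d' → d' ≤ n →
      d + (a' + b') ≤ d' + (a + b)
    over-minimal {a} {b} {d} {a'} {b'} {d'} (_ , d≤n , o) S size d'≤n = bound _ _ o
      (≤-trans (wt-⊆ n ⟦ c ⟧ a b d 0 0 n λ i j (_ , _ , l) → inj₁ (z≤n , z≤n , <-≤-trans l d≤n))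
        (subst (_≤ wt n ⟦ c ⟧ a' b' d') (cnt≡wt n c 0 0 n ≤-refl) (supported-card S)))
      (excess≤1 a' b' d' size d'≤n)
      where
      bound : ∀ w w' → d < w + (a + b) → w ≤ w' → w' + (a' + b') ≤ suc d' → d + (a' + b') ≤ d' + (a + b)
      bound w w' h h' h″ = lin 0 (+-mono-≤ (+-mono-≤ h h') h″) (eq d a' b' w a b w' d')
        where
        eq : ∀ d a' b' w a b w' d' → d + (a' + b') + (w + (a + b) + w' + suc d') + 0 ≡
          d' + (a + b) + (suc d + w + (w' + (a' + b')))
        eq = solve-∀

    oversat⇒over : ∀ {a b k} → LatTri n a b k → OverSat c a b k → Over n c a b (a + b + k)
    oversat⇒over {a} {b} {k} (_ , d≤n) o = m≤m+n (a + b) k , d≤n ,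
      subst (a + b + k <_) (trans (+-comm (a + b) _) (cong (_+ (a + b)) (cnt≡wt n c a b k d≤n))) (+-monoʳ-< (a + b) o)

    hull-only : HullOnlyOverSat n c
    hull-only a b k lat = only , saturated
      where
      only : OverSat c a b k → IsHull n c a b k
      only o = lat , over-supported (oversat⇒over lat o) , λ a' b' k' lat' con' →
        cancel a b k a' b' k' (over-minimal {a} {b} (oversat⇒over lat o) con' (m≤m+n (a' + b') k') (proj₂ lat'))
        where
        cancel : ∀ a b k a' b' k' → a + b + k + (a' + b') ≤ a' + b' + k' + (a + b) → k ≤ k'
        cancel a b k a' b' k' h = lin 0 h (eq a b k a' b' k')
          where
          eq : ∀ a b k a' b' k' → k + (a' + b' + k' + (a + b)) + 0 ≡ k' + (a + b + k + (a' + b'))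
          eq = solve-∀
      -- Some over-saturated triangle, of size `k₁`, contains `c`, so the hull has `k ≤ k₁`. As the
      -- hull contains all of `c`, it holds more than `k₁` elements.
      saturated : IsHull n c a b k → OverSat c a b k
      saturated ((_ , d≤n) , con , least) = subst (k <_) (sym (cnt≡wt n c a b k d≤n))
        (≤-trans (s≤s k≤) (≤-trans big (≤-trans
          (wt-⊆ n ⟦ c ⟧ a₁ b₁ d₁ 0 0 n λ i j (_ , _ , l) → inj₁ (z≤n , z≤n , <-≤-trans l (proj₁ (proj₂ over))))
          (subst (_≤ wt n ⟦ c ⟧ a b (a + b + k)) (cnt≡wt n c 0 0 n ≤-refl) (supported-card {a} {b} con)))))
        where
        a₁ = proj₁ over-hull
        b₁ = proj₁ (proj₂ over-hull)
        d₁ = proj₁ (proj₂ (proj₂ over-hull))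
        over : Over n c a₁ b₁ d₁
        over = proj₂ (proj₂ (proj₂ over-hull))
        k₁ = d₁ ∸ (a₁ + b₁)
        k₁-eq : a₁ + b₁ + k₁ ≡ d₁
        k₁-eq = m+[n∸m]≡n (proj₁ over)
        big : suc k₁ ≤ wt n ⟦ c ⟧ a₁ b₁ d₁
        big = +-cancelʳ-≤ (a₁ + b₁) _ _ (subst (λ v → suc v ≤ wt n ⟦ c ⟧ a₁ b₁ d₁ + (a₁ + b₁))
                (trans (sym k₁-eq) (+-comm (a₁ + b₁) k₁)) (proj₂ (proj₂ over)))
        S₁ : Supported c a₁ b₁ (a₁ + b₁ + k₁)
        S₁ = subst (Supported c a₁ b₁) (sym k₁-eq) (over-supported over)
        nonempty : 1 ≤ k₁
        nonempty = let x , y , h = element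
                       p , q , l = S₁ x y h
                   in +-cancelˡ-< (a₁ + b₁) 0 k₁ (≤-<-trans (≤-trans (≤-reflexive (+-identityʳ _)) (+-mono-≤ p q)) l)
        k≤ : k ≤ k₁
        k≤ = least a₁ b₁ k₁ (nonempty , subst (_≤ n) (sym k₁-eq) (proj₁ (proj₂ over))) S₁

    -- A down triangle all of whose neighbours lie in c would make c the
    -- three-element circuit of a triangle of size 2.
    free-neighbour : ∀ i j → suc (i + j) < n → ∃[ r ] c (nbX r i j) (nbY r i j) ≡ false
    free-neighbour i j l with c i j in eA | c (suc i) j in eB | c i (suc j) in eC
    ... | false | _     | _     = A , eA
    ... | true  | false | _     = B , eB
    ... | true  | true  | false = C , eC
    ... | true  | true  | true  = ⊥-elim (<⇒≱ 4≤c (≤-trans (supported-card (over-supported {i} {j} over)) (≤-reflexive w≡3)))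
      where
      d≤n : i + j + 2 ≤ n
      d≤n = subst (_≤ n) (+-comm 2 (i + j)) l
      three : cnt c i j 2 ≡ 3
      three rewrite +-identityʳ i | +-identityʳ j | +-comm i 1 | +-comm j 1 | eA | eB | eC = refl
      w≡3 : wt n ⟦ c ⟧ i j (i + j + 2) ≡ 3
      w≡3 = trans (sym (cnt≡wt n c i j 2 d≤n)) three
      over : Over n c i j (i + j + 2)
      over = oversat⇒over (s≤s z≤n , d≤n) (≤-reflexive (sym three))

    min-type2 : MinType2IsOne n c
    min-type2 with over-hull | element
    ... | a , b , d , over@(size , d≤n , o) | x , y , h =
      (proj₁ tiled , cov⇒tiling {ts = proj₁ tiled} (proj₁ (proj₂ tiled)) , proj₂ (proj₂ tiled)) , lower d a+b<d d≤n o
      where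
      S : Supported c a b d
      S = over-supported over
      a+b<d : a + b < d
      a+b<d = let p , q , l = S x y h in ≤-<-trans (+-mono-≤ p q) l
      tight : Tight n (remove c x y) a b d
      tight = size , d≤n , ≤-pred (subst (d <_) (cong (_+ (a + b)) w≡) o)
        where
        w≡ : wt n ⟦ c ⟧ a b d ≡ suc (wt n ⟦ remove c x y ⟧ a b d)
        w≡ = trans (sym (wt-remove c x y a b d h (c⊆T x y h)))
               (trans (cong (wt n ⟦ remove c x y ⟧ a b d +_) (χ-in (S x y h))) (+-comm _ 1))
      tiled : Tiled1 (Reg 0 0 n c)
      tiled = fill a+b<d d≤n S (add-hole h (S x y h) (λ i j _ _ l → free-neighbour i j (<-≤-trans l d≤n))
                (rhomb-tiling n a b d (remove c x y) (remove-independent h) tight))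
      -- The bound `d` is split as `suc e` to fit `type2-bound`; over-saturation then leaves at
      -- least one tile of type 2.
      lower : ∀ d → a + b < d → d ≤ n → d < wt n ⟦ c ⟧ a b d + (a + b) → ∀ ts → Tiling n c ts → 1 ≤ numType2 ts
      lower (suc e) size d≤n o ts T = +-cancelˡ-< (suc e) 0 (numType2 ts)
        (≤-trans (≤-trans (≤-reflexive (cong suc (+-identityʳ (suc e)))) o) (type2-bound n a b e c ts (≤-pred size) d≤n T))

  -- From the hull and a tiling back to a circuit.

  module _ (oversat⇔hull : HullOnlyOverSat n c) (one-type2 : MinType2IsOne n c) where

    dependent : Dependent n c
    dependent I = descend (suc n) 0 0 n ≤-refl (1≤n n 4≤c , ≤-refl) λ i j h → z≤n , z≤n , c⊆T i j h
      where
      1≤n : ∀ n → 4 ≤ card n c → 1 ≤ n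
      1≤n (suc n) _ = s≤s z≤n
      -- A minimal triangle containing c is a hull, hence over-saturated.
      descend : ∀ m a b k → k < m → LatTri n a b k → Contains c a b k → ⊥
      descend (suc m) a b k k<m lat con = <⇒≱ (proj₂ (oversat⇔hull a b k lat) hull) (I a b k lat)
        where
        hull : IsHull n c a b k
        hull = lat , con , λ a' b' k' lat' con' →
          ≮⇒≥ λ k'<k → descend m a' b' k' (<-≤-trans k'<k (≤-pred k<m)) lat' con'

    -- A triangle over-saturated by `s` is over-saturated by `c`, hence is the hull and contains the
    -- element `(x,y)` of `c` missing from `s`. Then `c` exceeds its size by at least two, whereas
    -- `type2-bound` for a tiling with a single type-2 trapezoid allows an excess of one.
    minimal : ∀ s → s ⊂ᵤ c → Independent n s
    minimal s (s⊆c , x , y , cx , sx) a b zero    (() , _)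
    minimal s (s⊆c , x , y , cx , sx) a b (suc k) lat@(_ , d≤n) = ≮⇒≥ λ o →
      let w = wt n ⟦ remove c x y ⟧ a b d
          s≤w : cnt s a b (suc k) ≤ w
          s≤w = subst (_≤ w) (sym (cnt≡wt n s a b (suc k) d≤n)) (wt-mono n a b d s≤remove)
          w+χ = wt-remove c x y a b d cx (c⊆T x y cx)
          c-over : OverSat c a b (suc k)
          c-over = <-≤-trans o (≤-trans s≤w (subst (w ≤_) (trans w+χ (sym (cnt≡wt n c a b (suc k) d≤n))) (m≤m+n w _)))
          _ , con , _ = proj₁ (oversat⇔hull a b (suc k) lat) c-over
          ts , T , one = proj₁ one-type2
          w≡ : wt n ⟦ c ⟧ a b d ≡ suc w
          w≡ = trans (sym w+χ) (trans (cong (w +_) (χ-in (con x y cx))) (+-comm w 1))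
      in <⇒≱ (<-≤-trans o s≤w) (bound w
           (subst₂ (λ v m → v + (a + b) ≤ d + m) w≡ one (bound-d ts T)))
      where
      d = a + b + suc k
      bound-d : ∀ ts → Tiling n c ts → wt n ⟦ c ⟧ a b d + (a + b) ≤ d + numType2 ts
      bound-d ts T = subst (λ d → wt n ⟦ c ⟧ a b d + (a + b) ≤ d + numType2 ts) (sym (+-suc (a + b) k))
        (type2-bound n a b (a + b + k) c ts (m≤m+n (a + b) k) (subst (_≤ n) (+-suc (a + b) k) d≤n) T)
      bound : ∀ w → suc w + (a + b) ≤ a + b + suc k + 1 → w ≤ suc k
      bound w h = lin 0 h (eq w a b k)
        where
        eq : ∀ w a b k → w + (a + b + suc k + 1) + 0 ≡ suc k + (suc w + (a + b))
        eq = solve-∀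
      s≤remove : ∀ i j → ⟦ s ⟧ i j ≤ ⟦ remove c x y ⟧ i j
      s≤remove i j with s i j in e
      ... | false = z≤n
      ... | true  = ≤-reflexive (sym (cong ind (trans (remove-off c x y i j ij≢) (s⊆c i j e))))
        where
        ij≢ : ¬ (i ≡ x × j ≡ y)
        ij≢ (refl , refl) = contradiction (trans (sym e) sx) λ ()

theorem5p8 : (n : ℕ) (c : USet) → InTn n c → 4 ≤ card n c →
    (Circuit n c → HullOnlyOverSat n c × MinType2IsOne n c) ×
    (HullOnlyOverSat n c × MinType2IsOne n c → Circuit n c)
theorem5p8 n c c⊆T 4≤c =
  (λ circuit → hull-only c⊆T 4≤c circuit , min-type2 c⊆T 4≤c circuit) ,
  (λ (hull , min) → dependent c⊆T 4≤c hull min , minimal c⊆T 4≤c hull min)
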